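{- Let $m \ge 2$ be an integer, let $q$ be a prime power, and let $n \ge 3q^2$ be an integer. Then there exist an $m$-partite graph $G$, having a partition of its vertex set into $m$ independent sets each with at most $3q^2$ vertices, with maximum degree $\Delta(G) \le q + 2m$, and a globally $\left\lceil\frac{n}{q^2+q}\right\rceil$-bounded coloring of $K_{m\otimes n}$ which does not contain a properly colored copy of $G$.
   Context: $K_{m\otimes n}$ denotes the complete $m$-partite graph with exactly $n$ vertices in each of its $m$ classes. A coloring of a graph $H$ is an arbitrary edge-coloring $c: E(H)\to\mathbb{N}$ (not necessarily proper). A coloring $c$ is globally $k$-bounded if every color is used on at most $k$ edges of $H$. A copy of $G$ in $H$ is a subgraph of $H$ isomorphic to $G$ (no particular assignment of the parts of $G$ to the parts of $H$ is prescribed); it is properly colored if any two distinct edges of it sharing a vertex receive distinct colors. -}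

module Defs where

open import Data.Fin.Base using (Fin; _<_; quotient)
open import Data.Fin.Properties using (_≟_; _<?_)
import Data.Integer.Base as ℤ
open import Data.List.Base using (List; length; filter; map; mapMaybe; allFin; cartesianProduct)
open import Data.List.Extrema.Nat using (max)
open import Data.Maybe.Base using (Maybe; just; nothing)
import Data.Nat.Base as ℕ
open import Data.Nat.Base using (ℕ; suc; _+_; _*_; _^_; _≤_; NonZero)
import Data.Nat.Properties as ℕ
open import Data.Nat.Primality using (Prime; prime⇒nonZero)
open import Data.Product.Base using (Σ-syntax; ∃-syntax; _×_; _,_)
import Data.Rational.Unnormalised.Base as ℚᵘ
open import Data.Sum.Base using (_⊎_)
open import Function.Base using (_∘_)
open import Function.Bundles using (_⇔_)
open import Function.Definitions using (Injective)
open import Level using (0ℓ)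
open import Relation.Binary.Core using (Rel)
open import Relation.Binary.Definitions using (Decidable; Symmetric)
open import Relation.Binary.PropositionalEquality using (_≡_; _≢_; refl; sym)
open import Relation.Nullary.Decidable using (yes; no; ¬?)
open import Relation.Nullary.Negation using (¬_)
open import Relation.Unary using (Pred)

record PrimePower (q : ℕ) : Set where
  field
    base     : ℕ
    exponent : ℕ
    prime    : Prime base
    positive : 1 ≤ exponent
    equation : q ≡ base ^ exponent

primePower⇒nonZero : ∀ {q} → PrimePower q → NonZero q
primePower⇒nonZero record { base = p ; exponent = k ; prime = pr ; equation = refl } =
  ℕ.m^n≢0 p k {{prime⇒nonZero pr}}

q²+q-nonZero : ∀ {q} → PrimePower q → NonZero (q ^ 2 + q)
q²+q-nonZero {q} pp = ℕ.>-nonZero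
  (ℕ.≤-trans (ℕ.>-nonZero⁻¹ q {{primePower⇒nonZero pp}}) (ℕ.m≤n+m q (q ^ 2)))

-- The ceiling of the fraction n/d is a nonnegative integer, so the absolute
-- value only converts it to a natural number.
⌈_/_⌉ : (n d : ℕ) .{{_ : NonZero d}} → ℕ
⌈ n / d ⌉ = ℤ.∣ ℚᵘ.ceiling (ℤ.+ n ℚᵘ./ d) ∣

record Graph (N : ℕ) : Set₁ where
  field
    Adj    : Rel (Fin N) 0ℓ
    adj?   : Decidable Adj
    symm   : Symmetric Adj
    irrefl : ∀ v → ¬ Adj v v

open Graph public

-- An undirected edge is represented once, by its endpoints in increasing order.
-- The proofs are irrelevant, so edges are equal iff their endpoints are.
record Edge {N : ℕ} (G : Graph N) : Set where
  constructor edge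
  field
    src tgt    : Fin N
    .ordered   : src < tgt
    .connected : Adj G src tgt

open Edge public

Joins : ∀ {N} {G : Graph N} → Edge G → Fin N → Fin N → Set
Joins e u v = (src e ≡ u × tgt e ≡ v) ⊎ (src e ≡ v × tgt e ≡ u)

_IsEndOf_ : ∀ {N} {G : Graph N} → Fin N → Edge G → Set
v IsEndOf e = src e ≡ v ⊎ tgt e ≡ v

edges : ∀ {N} (G : Graph N) → List (Edge G)
edges {N} G = mapMaybe toEdge (cartesianProduct (allFin N) (allFin N))
  where
  toEdge : Fin N × Fin N → Maybe (Edge G)
  toEdge (u , v) with u <? v | adj? G u v
  ... | yes u<v | yes a = just (edge u v u<v a)
  ... | _       | _     = nothing

degree : ∀ {N} → Graph N → Fin N → ℕ
degree {N} G v = length (filter (adj? G v) (allFin N))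

maxDegree : ∀ {N} → Graph N → ℕ
maxDegree {N} G = max 0 (map (degree G) (allFin N))

-- A partition into m (possibly empty) independent sets, given by the function
-- sending each vertex to the index of its class.
record Partition {N : ℕ} (m : ℕ) (G : Graph N) : Set where
  field
    class       : Fin N → Fin m
    independent : ∀ {u v} → class u ≡ class v → ¬ Adj G u v

  classSize : Fin m → ℕ
  classSize i = length (filter (λ v → class v ≟ i) (allFin N))

open Partition public using (classSize)

-- The complete m-partite graph with n vertices in each class.  Vertices are
-- pairs in Fin m × Fin n, encoded in Fin (m * n) by combine/remQuot; the class
-- of a vertex is its first component.
K[_⊗_] : (m n : ℕ) → Graph (m * n)
K[ m ⊗ n ] = record
  { Adj    = λ u v → quotient {m} n u ≢ quotient n v
  ; adj?   = λ u v → ¬? (quotient n u ≟ quotient n v)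
  ; symm   = λ u≁v → u≁v ∘ sym
  ; irrefl = λ v v≁v → v≁v refl
  }

Coloring : ∀ {N} → Graph N → Set
Coloring H = Edge H → ℕ

GloballyBounded : ∀ {N} {H : Graph N} → ℕ → Coloring H → Set
GloballyBounded {H = H} k c = ∀ i → length (filter (λ e → c e ℕ.≟ i) (edges H)) ≤ k

record Subgraph {N : ℕ} (H : Graph N) : Set₁ where
  field
    V    : Pred (Fin N) 0ℓ
    E    : Pred (Edge H) 0ℓ
    ends : ∀ {e v} → E e → v IsEndOf e → V v

-- The subgraph S of H is isomorphic to G.
record IsCopyOf {M N : ℕ} (G : Graph M) {H : Graph N} (S : Subgraph H) : Set where
  open Subgraph S
  field
    f          : Fin M → Fin N
    injective  : Injective _≡_ _≡_ f
    image      : ∀ x → V x ⇔ (∃[ u ] f u ≡ x)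
    preserving : ∀ u v → Adj G u v ⇔ (∃[ e ] (E e × Joins e (f u) (f v)))

ProperlyColored : ∀ {N} {H : Graph N} → Coloring H → Subgraph H → Set
ProperlyColored c S = ∀ {e e′} → E e → E e′ → e ≢ e′ →
  (∃[ v ] (v IsEndOf e × v IsEndOf e′)) → c e ≢ c e′
  where open Subgraph S

ContainsProperlyColored : ∀ {M N} (H : Graph N) → Coloring H → Graph M → Set₁
ContainsProperlyColored H c G =
  Σ[ S ∈ Subgraph H ] (IsCopyOf G S × ProperlyColored c S)

module Submission where

-- Colour an edge of the host joining a vertex u to a vertex w of a higher class by
-- u, the class of w and the part of w, where every class is cut into q² + q parts
-- of size at most ⌈n/(q² + q)⌉.  Hence if more than q² + q vertices of one class
-- have pairwise common neighbours in a given lower class, then two of them lie in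
-- the same part and the two edges to their common neighbour have the same colour.
-- The guest forces this: a power of a path fixes its m-partition up to renaming the
-- classes, and two of its classes carry the point-line incidence graph of a
-- projective plane of order q, where any two points lie on a line and any two lines
-- meet, so it does not matter which of these two classes is mapped higher.
--
-- The plane is built over a field with q = p^k elements.  Roots of X^q - X are
-- adjoined formally to ℤ/p until it splits; in a residue field of the resulting
-- finite ring its roots are distinct, since the derivative is -1, and they form a
-- subfield, since x ↦ x^q is additive.

open import Defs
open import Algebra.Bundles using (AbelianGroup; CommutativeRing)
import Algebra.Construct.Pointwise as Pointwise
import Algebra.Morphism.Construct.Composition as Composition
import Algebra.Morphism.Construct.Identity as Identity
open import Algebra.Morphism.Structures using (IsRingHomomorphism)
import Algebra.Properties.CommutativeSemigroup as CommutativeSemigroupProperties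
import Algebra.Properties.CommutativeSemiring.Binomial as Binomial
import Algebra.Properties.CommutativeSemiring.Exp as Exp
import Algebra.Properties.Ring as RingProperties
import Algebra.Properties.Semiring.Mult as Mult
import Algebra.Properties.Semiring.Sum as SemiringSum
import Algebra.Solver.Ring.NaturalCoefficients.Default as NaturalCoefficients
import Data.Fin.Base as Fin
open import Data.Fin.Base using (Fin; zero; suc; toℕ; fromℕ; fromℕ<; inject₁; finToFun; funToFin)
import Data.Fin.Properties as Fin
open import Data.Fin.Properties
  using (all?; any?; finToFun-funToFin; toℕ<n; toℕ-fromℕ; toℕ-fromℕ<; toℕ-inject₁)
import Data.Integer.Base as ℤ
import Data.Integer.DivMod as ℤ
import Data.Integer.Divisibility.Signed as ℤ
import Data.Integer.Properties as ℤ
import Data.Integer.Tactic.RingSolver as ℤ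
open import Data.List.Base using (List; []; _∷_; tabulate)
open import Data.List.Relation.Unary.All using (All; []; _∷_)
import Data.List.Relation.Unary.All as All
import Data.List.Relation.Unary.All.Properties as All
import Data.Nat.Base as ℕ
open import Data.Nat.Base using (ℕ; zero; suc; _≤_; _<_; z≤n; s≤s; _∸_; _!)
open import Data.Nat.Combinatorics using (_C_; nCn≡1; nCk≡n!/k![n-k]!; k![n∸k]!∣n!)
import Data.Nat.Divisibility as ℕ
open import Data.Nat.Divisibility using (_∣_; divides; >⇒∤; ∣m⇒∣m*n; ∣-refl)
open import Data.Nat.DivMod using (m/n*n≡m)
open import Data.Nat.Primality using (Prime; euclidsLemma; prime⇒nonTrivial; prime⇒nonZero)
import Data.Nat.Properties as ℕ
open import Data.Product.Base using (Σ-syntax; ∃-syntax; _×_; _,_; proj₁; proj₂)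
open import Data.Sum.Base using (_⊎_; inj₁; inj₂; [_,_]′)
open import Data.Vec.Functional using (Vector; tail)
open import Function.Base using (id; _∘_)
open import Level using (0ℓ)
open import Relation.Binary.Definitions using (Decidable)
import Relation.Binary.PropositionalEquality as ≡
open import Relation.Binary.PropositionalEquality using (_≡_; _≢_)
import Relation.Binary.Reasoning.Setoid as SetoidReasoning
open import Relation.Nullary.Decidable using (Dec; yes; no; map′)
open import Relation.Nullary.Negation using (¬_; contradiction)

-- Ring homomorphisms

IsHom : (R S : CommutativeRing 0ℓ 0ℓ) →
        (CommutativeRing.Carrier R → CommutativeRing.Carrier S) → Set
IsHom R S = IsRingHomomorphism (CommutativeRing.rawRing R) (CommutativeRing.rawRing S)

module _ (R S : CommutativeRing 0ℓ 0ℓ)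
         {h : CommutativeRing.Carrier R → CommutativeRing.Carrier S} where
  private
    module R = CommutativeRing R
    module S = CommutativeRing S
  open RingProperties S.ring using (x+x≈x⇒x≈0; +-inverseʳ-unique)

  -- Additivity forces zero and negatives to be preserved: the image of zero equals its own double,
  -- and additive inverses are unique.
  mkHom : (∀ {x y} → x R.≈ y → h x S.≈ h y) →
          (∀ x y → h (x R.+ y) S.≈ h x S.+ h y) →
          (∀ x y → h (x R.* y) S.≈ h x S.* h y) →
          h R.1# S.≈ S.1# → IsHom R S h
  mkHom cong +-homo *-homo 1#-homo = record
    { isSemiringHomomorphism = record
      { isNearSemiringHomomorphism = record
        { +-isMonoidHomomorphism = record
          { isMagmaHomomorphism = record
            { isRelHomomorphism = record { cong = cong }
            ; homo = +-homo
            }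
          ; ε-homo = 0#-homo
          }
        ; *-homo = *-homo
        }
      ; 1#-homo = 1#-homo
      }
    ; -‿homo = λ x → +-inverseʳ-unique (h x) (h (R.- x))
        (S.trans (S.sym (+-homo x (R.- x))) (S.trans (cong (R.-‿inverseʳ x)) 0#-homo))
    }
    where
    0#-homo : h R.0# S.≈ S.0#
    0#-homo = x+x≈x⇒x≈0 (h R.0#)
      (S.trans (S.sym (+-homo R.0# R.0#)) (cong (R.+-identityˡ R.0#)))

-- Monic polynomials, division by linear factors, splitting

-- A polynomial is monic: f : Vector Carrier d stands for X^d + Σ_{i<d} f i X^i.

module Polynomial (R : CommutativeRing 0ℓ 0ℓ) where
  open CommutativeRing R hiding (zero)
  open NaturalCoefficients commutativeSemiring using (solve; _:=_; _:+_; _:*_)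
  open SetoidReasoning setoid

  eval : ∀ {d} → Vector Carrier d → Carrier → Carrier
  eval {zero}  f x = 1#
  eval {suc d} f x = x * eval (tail f) x + f zero

  -- The formal derivative, by the product rule for `X * g + c`.
  deriv : ∀ {d} → Vector Carrier d → Carrier → Carrier
  deriv {zero}  f x = 0#
  deriv {suc d} f x = x * deriv (tail f) x + eval (tail f) x

  -- Synthetic division by `X - y`: the coefficients are the intermediate values of Horner's scheme
  -- for `eval f y`, which is itself the remainder.
  divide : ∀ {d} → Vector Carrier (suc d) → Carrier → Vector Carrier d
  divide {suc d} f y zero    = eval (tail f) y
  divide {suc d} f y (suc i) = divide (tail f) y i

  -- The roots are part of the data, one for each linear factor split off, so that they can later
  -- serve as an indexed list of field elements.
  data Splits : ∀ {d} → Vector Carrier d → Set where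
    done : {f : Vector Carrier 0} → Splits f
    step : ∀ {d} {f : Vector Carrier (suc d)} y → eval f y ≈ 0# → Splits (divide f y) → Splits f

  eval-cong : ∀ {d} {f g : Vector Carrier d} {x y} → (∀ i → f i ≈ g i) → x ≈ y → eval f x ≈ eval g y
  eval-cong {zero}  f≋g x≈y = refl
  eval-cong {suc d} f≋g x≈y =
    +-cong (*-cong x≈y (eval-cong (λ i → f≋g (suc i)) x≈y)) (f≋g zero)

  divide-cong : ∀ {d} {f g : Vector Carrier (suc d)} {y} → (∀ i → f i ≈ g i) →
                ∀ i → divide f y i ≈ divide g y i
  divide-cong {suc d} f≋g zero    = eval-cong (λ i → f≋g (suc i)) refl
  divide-cong {suc d} f≋g (suc i) = divide-cong (λ j → f≋g (suc j)) i

  Splits-cong : ∀ {d} {f g : Vector Carrier d} → (∀ i → f i ≈ g i) → Splits f → Splits g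
  Splits-cong f≋g done          = done
  Splits-cong f≋g (step y fy s) =
    step y (trans (sym (eval-cong f≋g refl)) fy) (Splits-cong (divide-cong f≋g) s)

  eval-divide : ∀ {d} (f : Vector Carrier (suc d)) x y →
                eval f x ≈ (x - y) * eval (divide f y) x + eval f y
  eval-divide {zero} f x y = begin
    x * 1# + f zero                    ≈⟨ +-identityʳ _ ⟨
    -- The solver works over semirings and treats `- y` as an unknown, so the zero term
    -- `(- y + y) * 1#` is supplied by hand.
    x * 1# + f zero + 0#               ≈⟨ +-congˡ (trans (*-congʳ (-‿inverseˡ y)) (zeroˡ 1#)) ⟨
    x * 1# + f zero + (- y + y) * 1#
      ≈⟨ solve 5 (λ x y n o c → x :* o :+ c :+ (n :+ y) :* o := (x :+ n) :* o :+ (y :* o :+ c))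
           refl x y (- y) 1# (f zero) ⟩
    (x - y) * 1# + (y * 1# + f zero)   ∎
  eval-divide {suc d} f x y = begin
    x * eval (tail f) x + f zero
      ≈⟨ +-congʳ (*-congˡ (eval-divide (tail f) x y)) ⟩
    x * ((x - y) * Q + Fy) + f zero
      ≈⟨ trans (+-congˡ (trans (*-congʳ (-‿inverseˡ y)) (zeroˡ Fy))) (+-identityʳ _) ⟨
    x * ((x - y) * Q + Fy) + f zero + (- y + y) * Fy
      ≈⟨ solve 6 (λ x y n Q F c → x :* ((x :+ n) :* Q :+ F) :+ c :+ (n :+ y) :* F
                   := (x :+ n) :* (x :* Q :+ F) :+ (y :* F :+ c))
           refl x y (- y) Q Fy (f zero) ⟩
    (x - y) * (x * Q + Fy) + (y * Fy + f zero) ∎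
    where
    Q  = eval (divide (tail f) y) x
    Fy = eval (tail f) y

  -- Differentiate `f = (X - y) * divide f y + eval f y`. At `x = y` this identifies `deriv f y`
  -- with the value of the quotient.
  deriv-divide : ∀ {d} (f : Vector Carrier (suc d)) x y →
                 deriv f x ≈ (x - y) * deriv (divide f y) x + eval (divide f y) x
  deriv-divide {zero}  f x y = +-congʳ (trans (zeroʳ x) (sym (zeroʳ (x - y))))
  deriv-divide {suc d} f x y = begin
    x * deriv (tail f) x + eval (tail f) x
      ≈⟨ +-cong (*-congˡ (deriv-divide (tail f) x y)) (eval-divide (tail f) x y) ⟩
    x * ((x - y) * DQ + Q) + ((x - y) * Q + Fy)
      ≈⟨ solve 5 (λ x z D Q F → x :* (z :* D :+ Q) :+ (z :* Q :+ F)
                   := z :* (x :* D :+ Q) :+ (x :* Q :+ F))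
           refl x (x - y) DQ Q Fy ⟩
    (x - y) * (x * DQ + Q) + (x * Q + Fy) ∎
    where
    DQ = deriv (divide (tail f) y) x
    Q  = eval (divide (tail f) y) x
    Fy = eval (tail f) y

module _ (R S : CommutativeRing 0ℓ 0ℓ)
         {h : CommutativeRing.Carrier R → CommutativeRing.Carrier S}
         (h-isHom : IsHom R S h) where
  private
    module R = CommutativeRing R
    module S = CommutativeRing S
    module PR = Polynomial R
    module PS = Polynomial S
  open IsRingHomomorphism h-isHom

  eval-hom : ∀ {d} (f : Vector R.Carrier d) x → h (PR.eval f x) S.≈ PS.eval (λ i → h (f i)) (h x)
  eval-hom {zero}  f x = 1#-homo
  eval-hom {suc d} f x = S.trans (+-homo _ _)
    (S.+-congʳ (S.trans (*-homo _ _) (S.*-congˡ (eval-hom (tail f) x))))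

  divide-hom : ∀ {d} (f : Vector R.Carrier (suc d)) y i →
               h (PR.divide f y i) S.≈ PS.divide (λ j → h (f j)) (h y) i
  divide-hom {suc d} f y zero    = eval-hom (tail f) y
  divide-hom {suc d} f y (suc i) = divide-hom (tail f) y i

Splits-hom : ∀ R S {h} → IsHom R S h → ∀ {d} {f : Fin d → CommutativeRing.Carrier R} →
             Polynomial.Splits R f → Polynomial.Splits S (λ i → h (f i))
Splits-hom R S h-isHom Polynomial.done = Polynomial.done
Splits-hom R S {h} h-isHom {f = f} (Polynomial.step y fy≈0 s) = Polynomial.step (h y)
  (S.trans (S.sym (eval-hom R S h-isHom f y)) (S.trans (H.⟦⟧-cong fy≈0) H.0#-homo))
  (Polynomial.Splits-cong S (divide-hom R S h-isHom f y) (Splits-hom R S h-isHom s))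
  where
  module S = CommutativeRing S
  module H = IsRingHomomorphism h-isHom

-- Adjoining a root of a monic polynomial

-- R[X]/(f), represented by remainders; multiplication by X is the companion
-- operator T, and a polynomial a acts on remainders as a(T).

module Adjoin (R : CommutativeRing 0ℓ 0ℓ) {d : ℕ}
              (f : Vector (CommutativeRing.Carrier R) (suc d)) where
  private module R = CommutativeRing R
  open R using (Carrier; _≈_; _+_; _*_; -_; 0#; 1#)
  open CommutativeSemigroupProperties R.*-commutativeSemigroup using (x∙yz≈y∙xz)

  pointwise : AbelianGroup 0ℓ 0ℓ
  pointwise = Pointwise.abelianGroup (Fin (suc d)) R.+-abelianGroup

  private module M = AbelianGroup pointwise
  open M using () renaming (_≈_ to _≋_; _∙_ to _⊕_; ε to 𝟎)
  open CommutativeSemigroupProperties M.commutativeSemigroup using (interchange)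
  open SetoidReasoning M.setoid

  M : Set
  M = Vector Carrier (suc d)

  infixr 8 _·_
  _·_ : Carrier → M → M
  (c · v) i = c * v i

  ·-cong : ∀ {b c u v} → b ≈ c → u ≋ v → b · u ≋ c · v
  ·-cong b≈c u≋v i = R.*-cong b≈c (u≋v i)

  ·-distribˡ : ∀ c u v → c · (u ⊕ v) ≋ c · u ⊕ c · v
  ·-distribˡ c u v i = R.distribˡ c (u i) (v i)

  ·-distribʳ : ∀ u b c → (b + c) · u ≋ b · u ⊕ c · u
  ·-distribʳ u b c i = R.distribʳ (u i) b c

  ·-swap : ∀ b c v → b · c · v ≋ c · b · v
  ·-swap b c v i = x∙yz≈y∙xz b c (v i)

  shift : M → M
  shift v zero    = 0#
  shift v (suc i) = v (inject₁ i)

  -- The coefficient pushed out at the top belongs to `X^(d+1)`, which reduces to `- f`.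
  T : M → M
  T v i = shift v i + v (fromℕ d) * - f i

  private
    shift-cong : ∀ {u v} → u ≋ v → shift u ≋ shift v
    shift-cong u≋v zero    = R.refl
    shift-cong u≋v (suc i) = u≋v (inject₁ i)

    shift-⊕ : ∀ u v → shift (u ⊕ v) ≋ shift u ⊕ shift v
    shift-⊕ u v zero    = R.sym (R.+-identityˡ 0#)
    shift-⊕ u v (suc i) = R.refl

    shift-· : ∀ c v → shift (c · v) ≋ c · shift v
    shift-· c v zero    = R.sym (R.zeroʳ c)
    shift-· c v (suc i) = R.refl

  T-cong : ∀ {u v} → u ≋ v → T u ≋ T v
  T-cong u≋v i = R.+-cong (shift-cong u≋v i) (R.*-congʳ (u≋v (fromℕ d)))

  T-⊕ : ∀ u v → T (u ⊕ v) ≋ T u ⊕ T v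
  T-⊕ u v = M.trans
    (M.∙-cong (shift-⊕ u v) (λ i → R.distribʳ (- f i) (u (fromℕ d)) (v (fromℕ d))))
    (interchange (shift u) (shift v) _ _)

  T-· : ∀ c v → T (c · v) ≋ c · T v
  T-· c v = M.trans
    (M.∙-cong (shift-· c v) (λ i → R.*-assoc c (v (fromℕ d)) (- f i)))
    (M.sym (·-distribˡ c (shift v) _))

  T-𝟎 : T 𝟎 ≋ 𝟎
  T-𝟎 zero    = R.trans (R.+-identityˡ _) (R.zeroˡ _)
  T-𝟎 (suc i) = R.trans (R.+-identityˡ _) (R.zeroˡ _)

  -- Horner's scheme for `a(T) v`. The length `k` is free so that inductions can pass to `tail a`;
  -- the ring product is the case `k = suc d`.
  act : ∀ {k} → Vector Carrier k → M → M
  act {zero}  a v = 𝟎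
  act {suc k} a v = a zero · v ⊕ T (act (tail a) v)

  act-cong : ∀ {k} {a b : Vector Carrier k} {u v} → (∀ i → a i ≈ b i) → u ≋ v → act a u ≋ act b v
  act-cong {zero}  a≋b u≋v = M.refl
  act-cong {suc k} a≋b u≋v =
    M.∙-cong (·-cong (a≋b zero) u≋v) (T-cong (act-cong (λ i → a≋b (suc i)) u≋v))

  act-⊕ : ∀ {k} (a : Vector Carrier k) u v → act a (u ⊕ v) ≋ act a u ⊕ act a v
  act-⊕ {zero}  a u v = M.sym (M.identityˡ 𝟎)
  act-⊕ {suc k} a u v = begin
    a zero · (u ⊕ v) ⊕ T (act (tail a) (u ⊕ v))
      ≈⟨ M.∙-cong (·-distribˡ (a zero) u v)
                  (M.trans (T-cong (act-⊕ (tail a) u v)) (T-⊕ _ _)) ⟩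
    (a zero · u ⊕ a zero · v) ⊕ (T (act (tail a) u) ⊕ T (act (tail a) v))
      ≈⟨ interchange _ _ _ _ ⟩
    act a u ⊕ act a v ∎

  act-· : ∀ {k} (a : Vector Carrier k) c v → act a (c · v) ≋ c · act a v
  act-· {zero}  a c v = λ i → R.sym (R.zeroʳ c)
  act-· {suc k} a c v = begin
    a zero · c · v ⊕ T (act (tail a) (c · v))
      ≈⟨ M.∙-cong (·-swap (a zero) c v)
                  (M.trans (T-cong (act-· (tail a) c v)) (T-· c _)) ⟩
    c · a zero · v ⊕ c · T (act (tail a) v)
      ≈⟨ ·-distribˡ c _ _ ⟨
    c · act a v ∎

  act-T : ∀ {k} (a : Vector Carrier k) v → act a (T v) ≋ T (act a v)
  act-T {zero}  a v = M.sym T-𝟎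
  act-T {suc k} a v = begin
    a zero · T v ⊕ T (act (tail a) (T v))
      ≈⟨ M.∙-cong (M.sym (T-· (a zero) v)) (T-cong (act-T (tail a) v)) ⟩
    T (a zero · v) ⊕ T (T (act (tail a) v))
      ≈⟨ T-⊕ _ _ ⟨
    T (act a v) ∎

  -- Both operators are polynomials in the single operator `T`, and these commute.
  act-act : ∀ {k l} (a : Vector Carrier k) (b : Vector Carrier l) v →
            act a (act b v) ≋ act b (act a v)
  act-act {zero}  {zero}  a b v = M.refl
  act-act {zero}  {suc l} a b v = begin
    𝟎 ≈⟨ M.identityˡ 𝟎 ⟨
    𝟎 ⊕ 𝟎 ≈⟨ M.∙-cong (λ i → R.sym (R.zeroʳ (b zero)))
                       (M.trans (M.sym T-𝟎) (T-cong (act-act a (tail b) v))) ⟩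
    act b 𝟎 ∎
  act-act {suc k} a b v = begin
    a zero · act b v ⊕ T (act (tail a) (act b v))
      ≈⟨ M.∙-cong (M.sym (act-· b (a zero) v))
                  (M.trans (T-cong (act-act (tail a) b v)) (M.sym (act-T b _))) ⟩
    act b (a zero · v) ⊕ act b (T (act (tail a) v))
      ≈⟨ act-⊕ b _ _ ⟨
    act b (act a v) ∎

  act-⊕ˡ : ∀ {k} (a b : Vector Carrier k) v →
           act (λ i → a i + b i) v ≋ act a v ⊕ act b v
  act-⊕ˡ {zero}  a b v = M.sym (M.identityˡ 𝟎)
  act-⊕ˡ {suc k} a b v = begin
    (a zero + b zero) · v ⊕ T (act (λ i → tail a i + tail b i) v)
      ≈⟨ M.∙-cong (·-distribʳ v (a zero) (b zero))
                  (M.trans (T-cong (act-⊕ˡ (tail a) (tail b) v)) (T-⊕ _ _)) ⟩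
    (a zero · v ⊕ b zero · v) ⊕ (T (act (tail a) v) ⊕ T (act (tail b) v))
      ≈⟨ interchange _ _ _ _ ⟩
    act a v ⊕ act b v ∎

  𝟏 : M
  𝟏 zero    = 1#
  𝟏 (suc i) = 0#

  private
    pad : ∀ {k n} → Vector Carrier k → Vector Carrier n
    pad {zero}  a i       = 0#
    pad {suc k} a zero    = a zero
    pad {suc k} a (suc i) = pad (tail a) i

    pad-inject₁ : ∀ {k n} (a : Vector Carrier k) (i : Fin n) → pad a (inject₁ i) ≈ pad a i
    pad-inject₁ {zero}  a i       = R.refl
    pad-inject₁ {suc k} a zero    = R.refl
    pad-inject₁ {suc k} a (suc i) = pad-inject₁ (tail a) i

    pad-last : ∀ {k n} → k ≤ n → (a : Vector Carrier k) → pad a (fromℕ n) ≈ 0#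
    pad-last {zero}          k≤n       a = R.refl
    pad-last {suc k} {suc n} (s≤s k≤n) a = pad-last k≤n (tail a)

    pad-id : ∀ {k} (a : Vector Carrier k) i → pad a i ≈ a i
    pad-id {suc k} a zero    = R.refl
    pad-id {suc k} a (suc i) = pad-id (tail a) i

    -- With at most `suc d` coefficients nothing overflows: the padded tail has a zero in the top
    -- position, so `T` is a plain shift on it.
    act-𝟏-pad : ∀ {k} → k ≤ suc d → (a : Vector Carrier k) → act a 𝟏 ≋ pad a
    act-𝟏-pad {zero}  _         a = M.refl
    act-𝟏-pad {suc k} (s≤s k≤d) a = M.trans
      (M.∙-congˡ {x = a zero · 𝟏} (T-cong (act-𝟏-pad (ℕ.m≤n⇒m≤1+n k≤d) (tail a)))) step
      where
      vanish : ∀ i → pad (tail a) (fromℕ d) * - f i ≈ 0#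
      vanish i = R.trans (R.*-congʳ (pad-last k≤d (tail a))) (R.zeroˡ _)

      step : a zero · 𝟏 ⊕ T (pad (tail a)) ≋ pad a
      step zero = R.trans
        (R.+-cong (R.*-identityʳ _) (R.trans (R.+-identityˡ _) (vanish zero)))
        (R.+-identityʳ _)
      step (suc i) = R.trans
        (R.+-cong (R.zeroʳ _)
          (R.trans (R.+-cong (pad-inject₁ (tail a) i) (vanish (suc i))) (R.+-identityʳ _)))
        (R.+-identityˡ _)

  act-𝟏 : ∀ v → act v 𝟏 ≋ v
  act-𝟏 v = M.trans (act-𝟏-pad ℕ.≤-refl v) (pad-id v)

  private
    -- Every remainder is recovered as `act v 𝟏`, so commuting operators give a commutative product;
    -- associativity then also reduces to `act-act`.
    act-comm : ∀ (u v : M) → act u v ≋ act v u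
    act-comm u v = begin
      act u v           ≈⟨ act-cong {a = u} (λ _ → R.refl) (act-𝟏 v) ⟨
      act u (act v 𝟏)   ≈⟨ act-act u v 𝟏 ⟩
      act v (act u 𝟏)   ≈⟨ act-cong {a = v} (λ _ → R.refl) (act-𝟏 u) ⟩
      act v u           ∎

    act-assoc : ∀ (u v w : M) → act (act u v) w ≋ act u (act v w)
    act-assoc u v w = begin
      act (act u v) w  ≈⟨ act-comm (act u v) w ⟩
      act w (act u v)  ≈⟨ act-act w u v ⟩
      act u (act w v)  ≈⟨ act-cong {a = u} (λ _ → R.refl) (act-comm w v) ⟩
      act u (act v w)  ∎

  extension : CommutativeRing 0ℓ 0ℓ
  extension = record
    { Carrier = M
    ; _≈_ = _≋_
    ; _+_ = _⊕_
    ; _*_ = act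
    ; -_ = M._⁻¹
    ; 0# = 𝟎
    ; 1# = 𝟏
    ; isCommutativeRing = record
      { isRing = record
        { +-isAbelianGroup = M.isAbelianGroup
        ; *-cong = act-cong {suc d}
        ; *-assoc = act-assoc
        ; *-identity = (λ v → M.trans (act-comm 𝟏 v) (act-𝟏 v)) , act-𝟏
        ; distrib = act-⊕ {suc d} , λ u a b → act-⊕ˡ a b u
        }
      ; *-comm = act-comm
      }
    }

  constant : Carrier → M
  constant c = c · 𝟏

  constant-* : ∀ c v → act (constant c) v ≋ c · v
  constant-* c v = begin
    act (constant c) v  ≈⟨ act-comm (constant c) v ⟩
    act v (constant c)  ≈⟨ act-· v c 𝟏 ⟩
    c · act v 𝟏         ≈⟨ ·-cong R.refl (act-𝟏 v) ⟩
    c · v               ∎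

  constant-isHom : IsHom R extension constant
  constant-isHom = mkHom R extension
    (λ b≈c → ·-cong b≈c M.refl)
    (·-distribʳ 𝟏)
    (λ b c → M.trans (λ i → R.*-assoc b c (𝟏 i))
      (M.sym {act (constant b) (constant c)} (constant-* b (constant c))))
    (λ i → R.*-identityˡ (𝟏 i))

  root : M
  root = T 𝟏

  private
    root-* : ∀ v → act root v ≋ T v
    root-* v = begin
      act root v   ≈⟨ act-comm root v ⟩
      act v (T 𝟏)  ≈⟨ act-T v 𝟏 ⟩
      T (act v 𝟏)  ≈⟨ T-cong (act-𝟏 v) ⟩
      T v          ∎

    T^ : ℕ → M
    T^ zero    = 𝟏
    T^ (suc k) = T (T^ k)

    monomial : ∀ k → Vector Carrier (suc k)
    monomial zero    i       = 1#
    monomial (suc k) zero    = 0#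
    monomial (suc k) (suc i) = monomial k i

    monomial-last : ∀ k → monomial k (fromℕ k) ≈ 1#
    monomial-last zero    = R.refl
    monomial-last (suc k) = monomial-last k

    shift-monomial : ∀ k (i : Fin k) → monomial k (inject₁ i) ≈ 0#
    shift-monomial (suc k) zero    = R.refl
    shift-monomial (suc k) (suc i) = shift-monomial k i

    act-monomial : ∀ k → act (monomial k) 𝟏 ≋ T^ k
    act-monomial zero = begin
      1# · 𝟏 ⊕ T 𝟎  ≈⟨ M.∙-cong (λ i → R.*-identityˡ (𝟏 i)) T-𝟎 ⟩
      𝟏 ⊕ 𝟎         ≈⟨ M.identityʳ 𝟏 ⟩
      𝟏             ∎
    act-monomial (suc k) = begin
      0# · 𝟏 ⊕ T (act (monomial k) 𝟏)
        ≈⟨ M.∙-cong (λ i → R.zeroˡ (𝟏 i)) (T-cong (act-monomial k)) ⟩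
      𝟎 ⊕ T (T^ k)
        ≈⟨ M.identityˡ _ ⟩
      T (T^ k) ∎

    -- `T^ d` is the monomial of degree `d`, whose only nonzero entry is a 1 at the top; one more
    -- `T` turns it into `- f`.
    T^-last : T^ (suc d) ⊕ f ≋ 𝟎
    T^-last = begin
      T (T^ d) ⊕ f                ≈⟨ M.∙-congʳ {x = f} (T-cong (act-monomial d)) ⟨
      T (act (monomial d) 𝟏) ⊕ f  ≈⟨ M.∙-congʳ {x = f} (T-cong (act-𝟏 (monomial d))) ⟩
      T (monomial d) ⊕ f          ≈⟨ cancel ⟩
      𝟎                           ∎
      where
      shift≈0 : ∀ i → shift (monomial d) i ≈ 0#
      shift≈0 zero    = R.refl
      shift≈0 (suc i) = shift-monomial d i

      cancel : T (monomial d) ⊕ f ≋ 𝟎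
      cancel i = R.trans
        (R.+-congʳ (R.trans
          (R.+-cong (shift≈0 i)
            (R.trans (R.*-congʳ (monomial-last d)) (R.*-identityˡ (- f i))))
          (R.+-identityˡ (- f i))))
        (R.-‿inverseˡ (f i))

  open Polynomial extension using (eval)

  private
    -- The leading coefficient, which the vector `g` leaves implicit, contributes `T^ k`; the listed
    -- coefficients contribute `act g 𝟏`.
    eval-root : ∀ {k} (g : Vector Carrier k) → eval (λ i → constant (g i)) root ≋ T^ k ⊕ act g 𝟏
    eval-root {zero}  g = M.sym (M.identityʳ 𝟏)
    eval-root {suc k} g = begin
      act root (eval (λ i → constant (tail g i)) root) ⊕ constant (g zero)
        ≈⟨ M.∙-congʳ {x = constant (g zero)} (root-* _) ⟩
      T (eval (λ i → constant (tail g i)) root) ⊕ constant (g zero)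
        ≈⟨ M.∙-congʳ {x = constant (g zero)}
             (M.trans (T-cong (eval-root (tail g))) (T-⊕ _ _)) ⟩
      (T^ (suc k) ⊕ T (act (tail g) 𝟏)) ⊕ constant (g zero)
        ≈⟨ M.trans (M.assoc _ _ _) (M.∙-congˡ {x = T^ (suc k)} (M.comm _ _)) ⟩
      T^ (suc k) ⊕ act g 𝟏 ∎

  eval-root≈0 : eval (λ i → constant (f i)) root ≋ 𝟎
  eval-root≈0 = begin
    eval (λ i → constant (f i)) root  ≈⟨ eval-root f ⟩
    T^ (suc d) ⊕ act f 𝟏              ≈⟨ M.∙-congˡ {x = T^ (suc d)} (act-𝟏 f) ⟩
    T^ (suc d) ⊕ f                    ≈⟨ T^-last ⟩
    𝟎                                 ∎

-- Quotients by principal ideals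

module Quotient (R : CommutativeRing 0ℓ 0ℓ) (a : CommutativeRing.Carrier R) where
  open CommutativeRing R hiding (zero)
  open NaturalCoefficients commutativeSemiring using (solve; _:=_; _:+_; _:*_)
  open RingProperties ring using (-‿+-comm; -‿distribˡ-*)
  open SetoidReasoning setoid

  -- Congruence modulo the ideal generated by `a`; the carrier stays the same.
  _∼_ : Carrier → Carrier → Set
  x ∼ y = ∃[ r ] x ≈ y + r * a

  ≈⇒∼ : ∀ {x y} → x ≈ y → x ∼ y
  ≈⇒∼ x≈y = 0# , trans x≈y (sym (trans (+-congˡ (zeroˡ a)) (+-identityʳ _)))

  private
    ∼-sym : ∀ {x y} → x ∼ y → y ∼ x
    ∼-sym {x} {y} (r , eq) = - r , (begin
      y
        ≈⟨ trans (+-congˡ (trans (*-congʳ (-‿inverseʳ r)) (zeroˡ a))) (+-identityʳ y) ⟨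
      y + (r + - r) * a
        ≈⟨ solve 4 (λ y r n a → y :+ (r :+ n) :* a := (y :+ r :* a) :+ n :* a)
            refl y r (- r) a ⟩
      (y + r * a) + - r * a  ≈⟨ +-congʳ eq ⟨
      x + - r * a            ∎)

    ∼-trans : ∀ {x y z} → x ∼ y → y ∼ z → x ∼ z
    ∼-trans {x} {y} {z} (r , eq) (s , eq′) = s + r , (begin
      x                    ≈⟨ eq ⟩
      y + r * a            ≈⟨ +-congʳ eq′ ⟩
      z + s * a + r * a
        ≈⟨ solve 4 (λ z s r a → z :+ s :* a :+ r :* a := z :+ (s :+ r) :* a) refl z s r a ⟩
      z + (s + r) * a      ∎)

    +-cong′ : ∀ {x y u v} → x ∼ y → u ∼ v → (x + u) ∼ (y + v)
    +-cong′ {x} {y} {u} {v} (r , eq) (s , eq′) = r + s , (begin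
      x + u                    ≈⟨ +-cong eq eq′ ⟩
      y + r * a + (v + s * a)
        ≈⟨ solve 5 (λ y r v s a → y :+ r :* a :+ (v :+ s :* a) := y :+ v :+ (r :+ s) :* a)
            refl y r v s a ⟩
      y + v + (r + s) * a      ∎)

    *-cong′ : ∀ {x y u v} → x ∼ y → u ∼ v → (x * u) ∼ (y * v)
    *-cong′ {x} {y} {u} {v} (r , eq) (s , eq′) = y * s + r * u , (begin
      x * u                            ≈⟨ *-congʳ eq ⟩
      (y + r * a) * u
        ≈⟨ solve 4 (λ y r u a → (y :+ r :* a) :* u := y :* u :+ r :* u :* a) refl y r u a ⟩
      y * u + r * u * a                ≈⟨ +-congʳ (*-congˡ eq′) ⟩
      y * (v + s * a) + r * u * a
        ≈⟨ solve 6 (λ y v s a r u → y :* (v :+ s :* a) :+ r :* u :* a := y :* v :+ (y :* s :+ r :* u) :* a)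
            refl y v s a r u ⟩
      y * v + (y * s + r * u) * a      ∎)

    neg-cong : ∀ {x y} → x ∼ y → (- x) ∼ (- y)
    neg-cong {x} {y} (r , eq) = - r , (begin
      - x              ≈⟨ -‿cong eq ⟩
      - (y + r * a)    ≈⟨ -‿+-comm y (r * a) ⟨
      - y + - (r * a)  ≈⟨ +-congˡ (-‿distribˡ-* r a) ⟩
      - y + - r * a    ∎)

  quotient : CommutativeRing 0ℓ 0ℓ
  quotient = record
    { Carrier = Carrier
    ; _≈_ = _∼_
    ; _+_ = _+_
    ; _*_ = _*_
    ; -_ = -_
    ; 0# = 0#
    ; 1# = 1#
    ; isCommutativeRing = record
      { isRing = record
        { +-isAbelianGroup = record
          { isGroup = record
            { isMonoid = record
              { isSemigroup = record
                { isMagma = record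
                  { isEquivalence = record { refl = ≈⇒∼ refl ; sym = ∼-sym ; trans = ∼-trans }
                  ; ∙-cong = +-cong′
                  }
                ; assoc = λ x y z → ≈⇒∼ (+-assoc x y z)
                }
              ; identity = (λ x → ≈⇒∼ (+-identityˡ x)) , (λ x → ≈⇒∼ (+-identityʳ x))
              }
            ; inverse = (λ x → ≈⇒∼ (-‿inverseˡ x)) , (λ x → ≈⇒∼ (-‿inverseʳ x))
            ; ⁻¹-cong = neg-cong
            }
          ; comm = λ x y → ≈⇒∼ (+-comm x y)
          }
        ; *-cong = *-cong′
        ; *-assoc = λ x y z → ≈⇒∼ (*-assoc x y z)
        ; *-identity = (λ x → ≈⇒∼ (*-identityˡ x)) , (λ x → ≈⇒∼ (*-identityʳ x))
        ; distrib = (λ x y z → ≈⇒∼ (distribˡ x y z)) , (λ x y z → ≈⇒∼ (distribʳ x y z))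
        }
      ; *-comm = λ x y → ≈⇒∼ (*-comm x y)
      }
    }

  quotient-isHom : IsHom R quotient id
  quotient-isHom = mkHom R quotient ≈⇒∼ (λ _ _ → ≈⇒∼ refl) (λ _ _ → ≈⇒∼ refl) (≈⇒∼ refl)

  generator∼0 : a ∼ 0#
  generator∼0 = 1# , sym (trans (+-identityˡ _) (*-identityˡ a))

-- Finite rings and formal splitting

record FiniteRing : Set₁ where
  field
    commutativeRing : CommutativeRing 0ℓ 0ℓ
  open CommutativeRing commutativeRing public hiding (zero)
  field
    _≟_             : Decidable _≈_
    size            : ℕ
    enum            : Fin size → Carrier
    -- Repetitions are allowed, so `size` only bounds the number of elements and the same
    -- enumeration serves for every quotient.
    enum-surjective : ∀ x → ∃[ i ] enum i ≈ x
    1≉0             : ¬ 1# ≈ 0#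

  search : {P : Carrier → Set} → (∀ x → Dec (P x)) → (∀ {x y} → x ≈ y → P x → P y) → Dec (∃[ x ] P x)
  search P? P-resp = map′
    (λ (i , p) → enum i , p)
    (λ (x , p) → proj₁ (enum-surjective x) , P-resp (sym (proj₂ (enum-surjective x))) p)
    (any? (λ i → P? (enum i)))

open FiniteRing using (commutativeRing)

finiteExtension : (A : FiniteRing) → ∀ {d} → Vector (FiniteRing.Carrier A) (suc d) → FiniteRing
finiteExtension A {d} f = record
  { commutativeRing = Adjoin.extension (commutativeRing A) f
  ; _≟_ = λ u v → all? (λ i → u i ≟ v i)
  ; size = size ℕ.^ suc d
  ; enum = λ k i → enum (finToFun k i)
  ; enum-surjective = λ v →
      let index i = proj₁ (enum-surjective (v i)) in
      funToFin index ,
      (λ i → trans (reflexive (≡.cong enum (finToFun-funToFin index i))) (proj₂ (enum-surjective (v i))))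
  ; 1≉0 = λ eq → 1≉0 (eq zero)
  }
  where open FiniteRing A hiding (commutativeRing)

composeHom : ∀ R S U {g h} → IsHom R S g → IsHom S U h → IsHom R U (h ∘ g)
composeHom R S U = Composition.isRingHomomorphism (CommutativeRing.trans U)

identityHom : ∀ R → IsHom R R id
identityHom R = Identity.isRingHomomorphism (CommutativeRing.rawRing R) (CommutativeRing.refl R)

-- A root is adjoined, its linear factor is divided out, and the quotient of smaller degree is split
-- over the extension. The result is only a finite ring; a field is made from it afterwards.
splittingRing : ∀ {d} (A : FiniteRing) (f : Vector (FiniteRing.Carrier A) d) →
  Σ[ B ∈ FiniteRing ] Σ[ h ∈ (FiniteRing.Carrier A → FiniteRing.Carrier B) ]
    (IsHom (commutativeRing A) (commutativeRing B) h
    × Polynomial.Splits (commutativeRing B) (λ i → h (f i)))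
splittingRing {zero}  A f = A , id , identityHom (commutativeRing A) , Polynomial.done
splittingRing {suc d} A f =
  C , g ∘ constant , composeHom (commutativeRing A) B C′ constant-isHom g-isHom ,
  step (g root)
    (C.trans (C.sym (eval-hom B C′ g-isHom (λ i → constant (f i)) root))
             (C.trans (⟦⟧-cong eval-root≈0) 0#-homo))
    (Splits-cong (divide-hom B C′ g-isHom _ root) splits)
  where
  open Adjoin (commutativeRing A) f renaming (extension to B)

  recursive = splittingRing (finiteExtension A f) (Polynomial.divide B (λ i → constant (f i)) root)
  C       = proj₁ recursive
  C′      = commutativeRing C
  g       = proj₁ (proj₂ recursive)
  g-isHom = proj₁ (proj₂ (proj₂ recursive))
  splits  = proj₂ (proj₂ (proj₂ recursive))
  module C = FiniteRing C
  open Polynomial C′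
  open IsRingHomomorphism g-isHom

-- Residue fields of finite rings

module _ (R : CommutativeRing 0ℓ 0ℓ) where
  open CommutativeRing R

  ZeroOrUnit : Carrier → Set
  ZeroOrUnit x = x ≈ 0# ⊎ (∃[ y ] y * x ≈ 1#)

  IsField : Set
  IsField = ∀ x → ZeroOrUnit x

  ZeroOrUnit-resp : ∀ {x y} → x ≈ y → ZeroOrUnit x → ZeroOrUnit y
  ZeroOrUnit-resp x≈y (inj₁ x≈0)      = inj₁ (trans (sym x≈y) x≈0)
  ZeroOrUnit-resp x≈y (inj₂ (z , eq)) = inj₂ (z , trans (*-congˡ (sym x≈y)) eq)

-- Elements once made zero or invertible remain so under all later quotients.
ZeroOrUnit-hom : ∀ R S {h} → IsHom R S h → ∀ {x} → ZeroOrUnit R x → ZeroOrUnit S (h x)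
ZeroOrUnit-hom R S {h} h-isHom = λ
  { (inj₁ x≈0)      → inj₁ (S.trans (⟦⟧-cong x≈0) 0#-homo)
  ; (inj₂ (y , eq)) → inj₂ (h y , S.trans (S.sym (*-homo y _)) (S.trans (⟦⟧-cong eq) 1#-homo))
  }
  where
  module S = CommutativeRing S
  open IsRingHomomorphism h-isHom

record FiniteQuotient (A : FiniteRing) : Set₁ where
  field
    ring       : FiniteRing
    proj       : FiniteRing.Carrier A → FiniteRing.Carrier ring
    isHom      : IsHom (commutativeRing A) (commutativeRing ring) proj
    surjective : ∀ y → ∃[ x ] FiniteRing._≈_ ring (proj x) y

-- For a non-unit `a` the quotient by `a` stays nontrivial: if 1 were congruent to 0, then 1 would
-- be a multiple of `a`.
killNonUnit : (A : FiniteRing) (a : FiniteRing.Carrier A) →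
  Σ[ Q ∈ FiniteQuotient A ]
    ZeroOrUnit (commutativeRing (FiniteQuotient.ring Q)) (FiniteQuotient.proj Q a)
killNonUnit A a with search (λ y → (y * a) ≟ 1#) (λ x≈y eq → trans (*-congʳ (sym x≈y)) eq)
  where open FiniteRing A hiding (commutativeRing)
... | yes unit = record
      { ring = A
      ; proj = id
      ; isHom = identityHom (commutativeRing A)
      ; surjective = λ y → y , FiniteRing.refl A
      } , inj₂ unit
... | no ¬unit = record
      { ring = record
        { commutativeRing = quotient
        ; _≟_ = λ x y → search (λ r → x ≟ (y + r * a))
                  (λ r≈s eq → trans eq (+-congˡ (*-congʳ r≈s)))
        ; size = size
        ; enum = enum
        ; enum-surjective = λ x → proj₁ (enum-surjective x) , ≈⇒∼ (proj₂ (enum-surjective x))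
        ; 1≉0 = λ (r , eq) → ¬unit (r , sym (trans eq (+-identityˡ _)))
        }
      ; proj = id
      ; isHom = quotient-isHom
      ; surjective = λ y → y , ≈⇒∼ refl
      } , inj₁ generator∼0
  where
  open FiniteRing A hiding (commutativeRing)
  open Quotient (commutativeRing A) a

-- A maximal ideal is built greedily: each element in turn is killed unless it is
-- already a unit.
killNonUnits : (A : FiniteRing) (xs : List (FiniteRing.Carrier A)) →
  Σ[ Q ∈ FiniteQuotient A ]
    All (λ x → ZeroOrUnit (commutativeRing (FiniteQuotient.ring Q)) (FiniteQuotient.proj Q x)) xs
killNonUnits A [] = record
  { ring = A
  ; proj = id
  ; isHom = identityHom (commutativeRing A)
  ; surjective = λ y → y , FiniteRing.refl A
  } , []
killNonUnits A (x ∷ xs) with killNonUnits A xs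
... | Q , pxs with killNonUnit (FiniteQuotient.ring Q) (FiniteQuotient.proj Q x)
...   | Q′ , px = record
  { ring = Q′.ring
  ; proj = Q′.proj ∘ Q.proj
  ; isHom = composeHom (commutativeRing A) (commutativeRing Q.ring) (commutativeRing Q′.ring)
              Q.isHom Q′.isHom
  ; surjective = λ z →
      let (y , eq) = Q′.surjective z
          (w , eq′) = Q.surjective y
      in w , FiniteRing.trans Q′.ring (IsRingHomomorphism.⟦⟧-cong Q′.isHom eq′) eq
  } , px ∷ All.map (ZeroOrUnit-hom (commutativeRing Q.ring) (commutativeRing Q′.ring) Q′.isHom) pxs
  where
  module Q = FiniteQuotient Q
  module Q′ = FiniteQuotient Q′

-- Every element of the quotient is the image of an enumerated element of `A`, and all of these have
-- been made zero or invertible.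
residueField : (A : FiniteRing) →
  Σ[ Q ∈ FiniteQuotient A ] IsField (commutativeRing (FiniteQuotient.ring Q))
residueField A with killNonUnits A (tabulate (FiniteRing.enum A))
... | Q , units = Q , λ y →
  let (x , eq)  = Q.surjective y
      (i , eq′) = FiniteRing.enum-surjective A x
  in ZeroOrUnit-resp (commutativeRing Q.ring)
       (FiniteRing.trans Q.ring (IsRingHomomorphism.⟦⟧-cong Q.isHom eq′) eq)
       (All.tabulate⁻ units i)
  where
  module Q = FiniteQuotient Q

-- The integers modulo p

ℤmod : (p : ℕ) → 2 ≤ p → FiniteRing
ℤmod p@(suc _) 2≤p = record
  { commutativeRing = quotient
  ; _≟_ = λ x y → map′
      (λ (ℤ.divides r eq) → r , ≡.trans (≡.sym (y+[x-y] x y)) (≡.cong (λ z → y ℤ.+ z) eq))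
      (λ (r , eq) → ℤ.divides r (≡.trans (≡.cong (λ z → z ℤ.- y) eq) ([y+z]-y y (r ℤ.* ℤ.+ p))))
      (ℤ.+ p ℤ.∣? (x ℤ.- y))
  ; size = p
  ; enum = λ i → ℤ.+ toℕ i
  ; enum-surjective = λ x → fromℕ< (ℤ.n%ℕd<d x p) ,
      ∼-sym (x ℤ./ℕ p , ≡.trans (ℤ.a≡a%ℕn+[a/ℕn]*n x p) (≡.cong
        (λ r → ℤ.+ r ℤ.+ (x ℤ./ℕ p) ℤ.* ℤ.+ p) (≡.sym (toℕ-fromℕ< (ℤ.n%ℕd<d x p)))))
  ; 1≉0 = λ (r , eq) →
      ℕ.>⇒≢ 2≤p (ℕ.∣1⇒≡1 (ℤ.∣⇒∣ᵤ (ℤ.divides r (≡.trans eq (ℤ.+-identityˡ _)))))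
  }
  where
  open Quotient ℤ.+-*-commutativeRing (ℤ.+ p)
  open CommutativeRing quotient using () renaming (sym to ∼-sym)
  y+[x-y] : ∀ x y → y ℤ.+ (x ℤ.- y) ≡ x
  y+[x-y] = ℤ.solve-∀
  [y+z]-y : ∀ y z → y ℤ.+ z ℤ.- y ≡ z
  [y+z]-y = ℤ.solve-∀

-- Fields with q elements

prime∤k! : ∀ {p} → Prime p → ∀ k → k < p → ¬ p ∣ k !
prime∤k! {p} pr zero    0<p p∣1 = >⇒∤ (ℕ.nonTrivial⇒n>1 p {{prime⇒nonTrivial pr}}) p∣1
prime∤k! {p} pr (suc k) k<p p∣k! with euclidsLemma (suc k) (k !) pr p∣k!
... | inj₁ p∣1+k = >⇒∤ k<p p∣1+k
... | inj₂ p∣k!′ = prime∤k! pr k (ℕ.<-trans (ℕ.n<1+n k) k<p) p∣k!′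

-- `p` divides `p ! = (p C k) * (k ! * (p ∸ k) !)` but neither of the two factorials.
prime∣pCk : ∀ {p} → Prime p → ∀ k → 0 < k → k < p → p ∣ p C k
prime∣pCk {p@(suc p-1)} pr k 0<k k<p
  with euclidsLemma (p C k) (k ! ℕ.* (p ∸ k) !) pr
         (≡.subst (p ∣_) (≡.sym pCk*k![p-k]!≡p!) (∣m⇒∣m*n (p-1 !) ∣-refl))
  where
  instance _ = k ℕ.!* (p ∸ k) !≢0
  pCk*k![p-k]!≡p! : (p C k) ℕ.* (k ! ℕ.* (p ∸ k) !) ≡ p !
  pCk*k![p-k]!≡p! = ≡.trans
    (≡.cong (ℕ._* (k ! ℕ.* (p ∸ k) !)) (nCk≡n!/k![n-k]! (ℕ.<⇒≤ k<p)))
    (m/n*n≡m (k![n∸k]!∣n! (ℕ.<⇒≤ k<p)))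
... | inj₁ p∣pCk = p∣pCk
... | inj₂ p∣k![p-k]! with euclidsLemma (k !) ((p ∸ k) !) pr p∣k![p-k]!
...   | inj₁ p∣k!     = contradiction p∣k! (prime∤k! pr k k<p)
...   | inj₂ p∣[p-k]! = contradiction p∣[p-k]! (prime∤k! pr (p ∸ k) (ℕ.∸-monoʳ-< 0<k (ℕ.<⇒≤ k<p)))

Annihilates : ℕ → CommutativeRing 0ℓ 0ℓ → Set
Annihilates n R = ∀ x → Mult._×_ semiring n x ≈ 0#
  where open CommutativeRing R

module Frobenius (R : CommutativeRing 0ℓ 0ℓ) {p : ℕ} (pr : Prime p) (p⋅x≈0 : Annihilates p R) where
  open CommutativeRing R hiding (zero)
  open Mult semiring using (×-congˡ; ×-assocˡ; ×-homo-1) renaming (_×_ to _⋅_)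
  open Exp commutativeSemiring using (_^_; ^-assocʳ; ^-congˡ)
  open SemiringSum semiring using (sum; sum-cong-≋; sum-replicate-zero; sum-init-last)
  open Binomial commutativeSemiring using (binomialTerm) renaming (theorem to binomialTheorem)
  open SetoidReasoning setoid

  private
    p∣n⇒n⋅x≈0 : ∀ {n} x → p ∣ n → n ⋅ x ≈ 0#
    p∣n⇒n⋅x≈0 x (divides k eq) = trans (×-congˡ (≡.trans eq (ℕ.*-comm k p)))
      (trans (sym (×-assocˡ x p k)) (p⋅x≈0 (k ⋅ x)))

  -- All binomial coefficients except the outer two are divisible by `p`.
  [x+y]^p : ∀ x y → (x + y) ^ p ≈ x ^ p + y ^ p
  [x+y]^p x y = go pr p∣n⇒n⋅x≈0
    where
    -- The exponent becomes a variable of its own, so that it can be matched as a successor and the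
    -- two outer terms can be split off.
    go : ∀ {n} → Prime n → (∀ {k} z → n ∣ k → k ⋅ z ≈ 0#) → (x + y) ^ n ≈ x ^ n + y ^ n
    go {n@(suc n-1)} n-prime vanish = begin
      (x + y) ^ n
        ≈⟨ binomialTheorem n x y ⟩
      term zero + sum (term ∘ suc)
        ≈⟨ +-congˡ (sum-init-last (term ∘ suc)) ⟩
      term zero + (sum (λ i → term (suc (inject₁ i))) + term (suc (fromℕ n-1)))
        ≈⟨ +-cong first (+-cong (trans (sum-cong-≋ middle) (sum-replicate-zero n-1)) last) ⟩
      y ^ n + (0# + x ^ n)
        ≈⟨ trans (+-congˡ (+-identityˡ _)) (+-comm _ _) ⟩
      x ^ n + y ^ n ∎
      where
      term = binomialTerm x y n

      first : term zero ≈ y ^ n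
      first = trans (×-homo-1 _) (*-identityˡ _)

      middle : ∀ i → term (suc (inject₁ i)) ≈ 0#
      middle i = vanish _ (prime∣pCk n-prime _ (s≤s z≤n)
        (s≤s (≡.subst (_< n-1) (≡.sym (toℕ-inject₁ i)) (toℕ<n i))))

      last : term (suc (fromℕ n-1)) ≈ x ^ n
      last rewrite toℕ-fromℕ n-1 | nCn≡1 n | ℕ.n∸n≡0 n-1 = trans (×-homo-1 _) (*-identityʳ _)

  [x+y]^p^k : ∀ k x y → (x + y) ^ (p ℕ.^ k) ≈ x ^ (p ℕ.^ k) + y ^ (p ℕ.^ k)
  [x+y]^p^k zero    x y = trans (*-identityʳ _) (sym (+-cong (*-identityʳ x) (*-identityʳ y)))
  [x+y]^p^k (suc k) x y = begin
    (x + y) ^ (p ℕ.* p ℕ.^ k)                          ≈⟨ ^-assocʳ (x + y) p (p ℕ.^ k) ⟨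
    ((x + y) ^ p) ^ (p ℕ.^ k)                          ≈⟨ ^-congˡ (p ℕ.^ k) ([x+y]^p x y) ⟩
    (x ^ p + y ^ p) ^ (p ℕ.^ k)                        ≈⟨ [x+y]^p^k k (x ^ p) (y ^ p) ⟩
    (x ^ p) ^ (p ℕ.^ k) + (y ^ p) ^ (p ℕ.^ k)
      ≈⟨ +-cong (^-assocʳ x p (p ℕ.^ k)) (^-assocʳ y p (p ℕ.^ k)) ⟩
    x ^ (p ℕ.* p ℕ.^ k) + y ^ (p ℕ.* p ℕ.^ k)          ∎

-- Roots of split polynomials over a field

module Roots (K : CommutativeRing 0ℓ 0ℓ)
  (1≉0 : ¬ CommutativeRing._≈_ K (CommutativeRing.1# K) (CommutativeRing.0# K))
  (isField : IsField K) where
  open CommutativeRing K hiding (zero)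
  open Polynomial K
  open RingProperties ring using (x∙y⁻¹≈ε⇒x≈y)
  open SetoidReasoning setoid

  noZeroDivisors : ∀ x y → x * y ≈ 0# → x ≈ 0# ⊎ y ≈ 0#
  noZeroDivisors x y xy≈0 with isField x
  ... | inj₁ x≈0        = inj₁ x≈0
  ... | inj₂ (z , zx≈1) = inj₂ (begin
    y            ≈⟨ *-identityˡ y ⟨
    1# * y       ≈⟨ *-congʳ zx≈1 ⟨
    z * x * y    ≈⟨ *-assoc z x y ⟩
    z * (x * y)  ≈⟨ *-congˡ xy≈0 ⟩
    z * 0#       ≈⟨ zeroʳ z ⟩
    0#           ∎)

  Separable : ∀ {d} → Vector Carrier d → Set
  Separable f = ∀ x → eval f x ≈ 0# → ¬ deriv f x ≈ 0#

  roots : ∀ {d} {f : Vector Carrier d} → Splits f → Vector Carrier d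
  roots (step y _ s) zero    = y
  roots (step y _ s) (suc i) = roots s i

  private
    lift-root : ∀ {d} (f : Vector Carrier (suc d)) {x y} → eval f y ≈ 0# →
                eval (divide f y) x ≈ 0# → eval f x ≈ 0#
    lift-root f {x} {y} fy≈0 qx≈0 = begin
      eval f x                                    ≈⟨ eval-divide f x y ⟩
      (x - y) * eval (divide f y) x + eval f y
        ≈⟨ +-cong (trans (*-congˡ qx≈0) (zeroʳ _)) fy≈0 ⟩
      0# + 0#                                     ≈⟨ +-identityˡ 0# ⟩
      0#                                          ∎

    -- By the product rule, a common zero of the quotient and its derivative is also one of `f` and
    -- its derivative.
    Separable-divide : ∀ {d} (f : Vector Carrier (suc d)) {y} →
                       eval f y ≈ 0# → Separable f → Separable (divide f y)
    Separable-divide f {y} fy≈0 sep x qx≈0 q′x≈0 = sep x (lift-root f fy≈0 qx≈0) (begin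
      deriv f x                                                   ≈⟨ deriv-divide f x y ⟩
      (x - y) * deriv (divide f y) x + eval (divide f y) x
        ≈⟨ +-cong (trans (*-congˡ q′x≈0) (zeroʳ _)) qx≈0 ⟩
      0# + 0#                                                     ≈⟨ +-identityˡ 0# ⟩
      0#                                                          ∎)

    -- At `y` the value of the quotient is `deriv f y`, which is nonzero at a root of a separable
    -- `f`.
    simple : ∀ {d} (f : Vector Carrier (suc d)) {y} →
             eval f y ≈ 0# → Separable f → ¬ eval (divide f y) y ≈ 0#
    simple f {y} fy≈0 sep qy≈0 = sep y fy≈0 (begin
      deriv f y                                                   ≈⟨ deriv-divide f y y ⟩
      (y - y) * deriv (divide f y) y + eval (divide f y) y
        ≈⟨ +-cong (trans (*-congʳ (-‿inverseʳ y)) (zeroˡ _)) qy≈0 ⟩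
      0# + 0#                                                     ≈⟨ +-identityˡ 0# ⟩
      0#                                                          ∎)

  roots-eval : ∀ {d} {f : Vector Carrier d} (s : Splits f) i → eval f (roots s i) ≈ 0#
  roots-eval {f = f} (step y fy≈0 s) zero    = fy≈0
  roots-eval {f = f} (step y fy≈0 s) (suc i) = lift-root f fy≈0 (roots-eval s i)

  -- A root `x` makes `(x - y) * eval (divide f y) x` vanish; without zero divisors it is `y` or a
  -- root of the quotient.
  roots-complete : ∀ {d} {f : Vector Carrier d} (s : Splits f) x → eval f x ≈ 0# →
                   ∃[ i ] roots s i ≈ x
  roots-complete done x 1≈0 = contradiction 1≈0 1≉0
  roots-complete {f = f} (step y fy≈0 s) x fx≈0
    with noZeroDivisors (x - y) (eval (divide f y) x)
           (trans (sym (trans (+-congˡ fy≈0) (+-identityʳ _)))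
             (trans (sym (eval-divide f x y)) fx≈0))
  ... | inj₁ x-y≈0 = zero , sym (x∙y⁻¹≈ε⇒x≈y x y x-y≈0)
  ... | inj₂ qx≈0  = let (i , eq) = roots-complete s x qx≈0 in suc i , eq

  -- A repetition of the first root would be a root of the quotient, contrary to `simple`; further
  -- repetitions are excluded by recursion, since the quotient is separable again.
  roots-injective : ∀ {d} {f : Vector Carrier d} (s : Splits f) → Separable f →
                    ∀ i j → roots s i ≈ roots s j → i ≡ j
  roots-injective {f = f} (step y fy≈0 s) sep zero    zero    eq = ≡.refl
  roots-injective {f = f} (step y fy≈0 s) sep zero    (suc j) eq = contradiction
    (trans (eval-cong {f = divide f y} (λ _ → refl) eq) (roots-eval s j)) (simple f fy≈0 sep)
  roots-injective {f = f} (step y fy≈0 s) sep (suc i) zero    eq = contradiction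
    (trans (eval-cong {f = divide f y} (λ _ → refl) (sym eq)) (roots-eval s i)) (simple f fy≈0 sep)
  roots-injective {f = f} (step y fy≈0 s) sep (suc i) (suc j) eq =
    ≡.cong suc (roots-injective s (Separable-divide f fy≈0 sep) i j eq)

-- The polynomial X^q - X and its derivative

module _ (R : CommutativeRing 0ℓ 0ℓ) where
  open CommutativeRing R hiding (zero)
  open Polynomial R
  open Mult semiring using (×-comm-*) renaming (_×_ to _⋅_)
  open Exp commutativeSemiring using (_^_)
  open SetoidReasoning setoid

  -- X^q - X, provided that q ≥ 2.
  frobeniusPolynomial : ∀ q → Vector Carrier q
  frobeniusPolynomial q zero          = 0#
  frobeniusPolynomial q (suc zero)    = - 1#
  frobeniusPolynomial q (suc (suc i)) = 0#

  private
    eval-monomial : ∀ j x → eval {j} (λ _ → 0#) x ≈ x ^ j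
    eval-monomial zero    x = refl
    eval-monomial (suc j) x = trans (+-identityʳ _) (*-congˡ (eval-monomial j x))

    -- The extra factor `x` avoids the exponent `j - 1`.
    deriv-monomial : ∀ j x → x * deriv {j} (λ _ → 0#) x ≈ j ⋅ (x ^ j)
    deriv-monomial zero    x = zeroʳ x
    deriv-monomial (suc j) x = begin
      x * (x * deriv {j} (λ _ → 0#) x + eval {j} (λ _ → 0#) x)
        ≈⟨ *-congˡ (+-cong (deriv-monomial j x) (eval-monomial j x)) ⟩
      x * (j ⋅ (x ^ j) + x ^ j)
        ≈⟨ trans (distribˡ x _ _) (trans (+-congʳ (×-comm-* j x (x ^ j))) (+-comm _ _)) ⟩
      suc j ⋅ (x ^ suc j) ∎

  eval-frobeniusPolynomial : ∀ {q} → 2 ≤ q → ∀ x → eval (frobeniusPolynomial q) x ≈ x ^ q - x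
  eval-frobeniusPolynomial {suc (suc j)} (s≤s (s≤s z≤n)) x = begin
    x * (x * eval {j} (λ _ → 0#) x - 1#) + 0#
      ≈⟨ trans (+-identityʳ _) (*-congˡ (+-congʳ (*-congˡ (eval-monomial j x)))) ⟩
    x * (x * x ^ j - 1#)
      ≈⟨ x[y-z]≈xy-xz x _ 1# ⟩
    x * (x * x ^ j) - x * 1#
      ≈⟨ +-congˡ (-‿cong (*-identityʳ x)) ⟩
    x ^ suc (suc j) - x ∎
    where open RingProperties ring using (x[y-z]≈xy-xz)

  deriv-frobeniusPolynomial : ∀ {q} → 2 ≤ q → Annihilates q R → ∀ x →
                              deriv (frobeniusPolynomial q) x ≈ - 1#
  deriv-frobeniusPolynomial {suc (suc j)} (s≤s (s≤s z≤n)) q⋅x≈0 x = begin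
    x * (x * D + E) + (x * E - 1#)
      ≈⟨ +-cong (*-congˡ (+-cong (deriv-monomial j x) (eval-monomial j x)))
                (+-congʳ (*-congˡ (eval-monomial j x))) ⟩
    x * (j ⋅ (x ^ j) + x ^ j) + (x ^ suc j - 1#)
      ≈⟨ trans (sym (+-assoc _ _ _))
               (+-congʳ (+-congʳ (trans (distribˡ x _ _) (+-congʳ (×-comm-* j x (x ^ j)))))) ⟩
    j ⋅ (x ^ suc j) + x ^ suc j + x ^ suc j - 1#
      ≈⟨ +-congʳ (trans (+-comm _ _) (+-congˡ (+-comm _ _))) ⟩
    -- The powers add up to `q` copies, and `q` annihilates the ring.
    suc (suc j) ⋅ (x ^ suc j) - 1#
      ≈⟨ trans (+-congʳ (q⋅x≈0 (x ^ suc j))) (+-identityˡ _) ⟩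
    - 1# ∎
    where
    D = deriv {j} (λ _ → 0#) x
    E = eval {j} (λ _ → 0#) x

-- The multiple `p ⋅ x` is the image of `p` times `x`, and `p` is already zero in the source of `h`.
ℤmod-characteristic : ∀ {p} (2≤p : 2 ≤ p) (R : CommutativeRing 0ℓ 0ℓ) {h} →
  IsHom (FiniteRing.commutativeRing (ℤmod p 2≤p)) R h → Annihilates p R
ℤmod-characteristic {p@(suc _)} 2≤p R {h} h-isHom x = begin
  p ⋅ x          ≈⟨ multiple p ⟩
  h (ℤ.+ p) * x  ≈⟨ *-congʳ (trans (⟦⟧-cong generator∼0) 0#-homo) ⟩
  0# * x         ≈⟨ zeroˡ x ⟩
  0#             ∎
  where
  open CommutativeRing R hiding (zero)
  open Mult semiring using () renaming (_×_ to _⋅_)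
  open SetoidReasoning setoid
  open IsRingHomomorphism h-isHom
  open Quotient ℤ.+-*-commutativeRing (ℤ.+ p) using (generator∼0)
  multiple : ∀ n → n ⋅ x ≈ h (ℤ.+ n) * x
  multiple zero    = sym (trans (*-congʳ 0#-homo) (zeroˡ x))
  multiple (suc n) = begin
    x + n ⋅ x                        ≈⟨ +-cong (sym (*-identityˡ x)) (multiple n) ⟩
    1# * x + h (ℤ.+ n) * x           ≈⟨ distribʳ x 1# _ ⟨
    (1# + h (ℤ.+ n)) * x             ≈⟨ *-congʳ (+-congʳ 1#-homo) ⟨
    (h (ℤ.+ 1) + h (ℤ.+ n)) * x      ≈⟨ *-congʳ (+-homo (ℤ.+ 1) (ℤ.+ n)) ⟨
    h (ℤ.+ suc n) * x                ∎

-- op m x y plays the role of m x - y over the field with q elements.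
record PlanarOperation (q : ℕ) : Set where
  field
    op         : Fin q → Fin q → Fin q → Fin q
    reciprocal : ∀ {m x y b} → op m x y ≡ b → op x m b ≡ y
    slope      : ∀ {x x′} y y′ → x ≢ x′ → ∃[ m ] op m x y ≡ op m x′ y′

prime⇒2≤ : ∀ {p} → Prime p → 2 ≤ p
prime⇒2≤ {p} pr = ℕ.nonTrivial⇒n>1 p {{prime⇒nonTrivial pr}}

frobeniusPolynomial-hom : ∀ R S {h} → IsHom R S h → ∀ q i →
  CommutativeRing._≈_ S (h (frobeniusPolynomial R q i)) (frobeniusPolynomial S q i)
frobeniusPolynomial-hom R S h-isHom = λ
  { q zero          → 0#-homo
  ; q (suc zero)    → S.trans (-‿homo _) (S.-‿cong 1#-homo)
  ; q (suc (suc i)) → 0#-homo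
  }
  where
  module S = CommutativeRing S
  open IsRingHomomorphism h-isHom

-- The subfield of roots of X^q - X and its planar operation

module FixedField (K : CommutativeRing 0ℓ 0ℓ)
  (1≉0 : ¬ CommutativeRing._≈_ K (CommutativeRing.1# K) (CommutativeRing.0# K))
  (isField : IsField K) {p : ℕ} (pr : Prime p)
  (p⋅x≈0 : Annihilates p K) (k-1 : ℕ)
  (splits : Polynomial.Splits K (frobeniusPolynomial K (p ℕ.^ suc k-1)))
  where
  open CommutativeRing K hiding (zero)
  open Polynomial K
  private
    k = suc k-1
    q = p ℕ.^ k
    f = frobeniusPolynomial K q

    2≤q : 2 ≤ q
    2≤q = ℕ.≤-trans (prime⇒2≤ pr)
      (ℕ.m≤m*n p (p ℕ.^ k-1) {{ℕ.m^n≢0 p k-1 {{prime⇒nonZero pr}}}})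

    open Mult semiring using (×-assocˡ) renaming (_×_ to _⋅_)
    open Exp commutativeSemiring using (_^_; ^-distrib-*; ^-congˡ)
    open RingProperties ring using (x∙y⁻¹≈ε⇒x≈y; x≈y⇒x∙y⁻¹≈ε; -‿involutive; -0#≈0#)
    open SetoidReasoning setoid

    q⋅x≈0 : Annihilates q K
    q⋅x≈0 x = trans (sym (×-assocˡ x p (p ℕ.^ k-1))) (p⋅x≈0 _)

    open Frobenius K pr p⋅x≈0 using ([x+y]^p^k)
    open Roots K 1≉0 isField

    separable : Separable f
    separable x _ f′x≈0 = 1≉0 (begin
      1#          ≈⟨ -‿involutive 1# ⟨
      - (- 1#)    ≈⟨ -‿cong (deriv-frobeniusPolynomial K 2≤q q⋅x≈0 x) ⟨
      - deriv f x ≈⟨ -‿cong f′x≈0 ⟩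
      - 0#        ≈⟨ -0#≈0# ⟩
      0#          ∎)

  element : Fin q → Carrier
  element = roots splits

  element-injective : ∀ i j → element i ≈ element j → i ≡ j
  element-injective = roots-injective splits separable

  private
    Fixed : Carrier → Set
    Fixed x = x ^ q ≈ x

    element-fixed : ∀ i → Fixed (element i)
    element-fixed i = x∙y⁻¹≈ε⇒x≈y _ _
      (trans (sym (eval-frobeniusPolynomial K 2≤q _)) (roots-eval splits i))

    element-complete : ∀ x → Fixed x → ∃[ i ] element i ≈ x
    element-complete x fixed = roots-complete splits x
      (trans (eval-frobeniusPolynomial K 2≤q x) (x≈y⇒x∙y⁻¹≈ε fixed))

    fixed-* : ∀ {x y} → Fixed x → Fixed y → Fixed (x * y)
    fixed-* {x} {y} fx fy = trans (^-distrib-* x y q) (*-cong fx fy)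

    -- Additivity of the `q`-th power is applied to `(x - y) + y = x`, which avoids powers of
    -- negatives.
    fixed-- : ∀ {x y} → Fixed x → Fixed y → Fixed (x - y)
    fixed-- {x} {y} fx fy = begin
      (x - y) ^ q                  ≈⟨ +-identityʳ _ ⟨
      (x - y) ^ q + 0#             ≈⟨ +-congˡ (-‿inverseʳ y) ⟨
      (x - y) ^ q + (y - y)        ≈⟨ +-assoc _ y (- y) ⟨
      (x - y) ^ q + y - y          ≈⟨ +-congʳ (+-congˡ fy) ⟨
      (x - y) ^ q + y ^ q - y      ≈⟨ +-congʳ ([x+y]^p^k k (x - y) y) ⟨
      (x - y + y) ^ q - y
        ≈⟨ +-congʳ (^-congˡ q (trans (+-assoc x (- y) y) (trans (+-congˡ (-‿inverseˡ y)) (+-identityʳ x)))) ⟩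
      x ^ q - y                    ≈⟨ +-congʳ fx ⟩
      x - y                        ∎

    1^n≈1 : ∀ n → 1# ^ n ≈ 1#
    1^n≈1 zero    = refl
    1^n≈1 (suc n) = trans (*-identityˡ _) (1^n≈1 n)

    -- `y ^ q` is an inverse of `x ^ q = x`, hence equal to `y`.
    fixed-inverse : ∀ {x y} → y * x ≈ 1# → Fixed x → Fixed y
    fixed-inverse {x} {y} yx≈1 fx = begin
      y ^ q                ≈⟨ *-identityʳ _ ⟨
      y ^ q * 1#           ≈⟨ *-congˡ (trans (*-comm x y) yx≈1) ⟨
      y ^ q * (x * y)      ≈⟨ *-assoc _ x y ⟨
      y ^ q * x * y        ≈⟨ *-congʳ (*-congˡ fx) ⟨
      y ^ q * x ^ q * y    ≈⟨ *-congʳ (^-distrib-* y x q) ⟨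
      (y * x) ^ q * y      ≈⟨ *-congʳ (trans (^-congˡ q yx≈1) (1^n≈1 q)) ⟩
      1# * y               ≈⟨ *-identityˡ y ⟩
      y                    ∎

    op-element : ∀ m x y → ∃[ b ] element b ≈ element m * element x - element y
    op-element m x y = element-complete _
      (fixed-- (fixed-* (element-fixed m) (element-fixed x)) (element-fixed y))

    op : Fin q → Fin q → Fin q → Fin q
    op m x y = proj₁ (op-element m x y)

    a≈b-c⇒c≈b-a : ∀ {a b c} → a ≈ b - c → c ≈ b - a
    a≈b-c⇒c≈b-a {a} {b} {c} eq = begin
      c              ≈⟨ +-identityˡ c ⟨
      0# + c         ≈⟨ +-congʳ (-‿inverseʳ a) ⟨
      a - a + c      ≈⟨ +-congʳ (+-congʳ eq) ⟩
      b - c - a + c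
        ≈⟨ solve 4 (λ b c′ a′ c → b :+ c′ :+ a′ :+ c := b :+ a′ :+ (c′ :+ c))
            refl b (- c) (- a) c ⟩
      b - a + (- c + c) ≈⟨ +-congˡ (-‿inverseˡ c) ⟩
      b - a + 0#     ≈⟨ +-identityʳ _ ⟩
      b - a          ∎
      where open NaturalCoefficients commutativeSemiring using (solve; _:=_; _:+_)

    reciprocal : ∀ {m x y b} → op m x y ≡ b → op x m b ≡ y
    reciprocal {m} {x} {y} ≡.refl = element-injective _ _ (trans (proj₂ (op-element x m (op m x y)))
      (trans (+-congʳ (*-comm _ _)) (sym (a≈b-c⇒c≈b-a (proj₂ (op-element m x y))))))

    slope : ∀ {x x′} y y′ → x ≢ x′ → ∃[ m ] op m x y ≡ op m x′ y′
    slope {x} {x′} y y′ x≢x′ with isField (element x - element x′)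
    ... | inj₁ x-x′≈0 = contradiction (element-injective x x′ (x∙y⁻¹≈ε⇒x≈y _ _ x-x′≈0)) x≢x′
    ... | inj₂ (z , zx≈1) = m , element-injective _ _ (begin
      element (op m x y)                        ≈⟨ proj₂ (op-element m x y) ⟩
      element m * X - Y                         ≈⟨ lemma ⟩
      element m * X′ - Y′                       ≈⟨ proj₂ (op-element m x′ y′) ⟨
      element (op m x′ y′)                      ∎)
      where
      open NaturalCoefficients commutativeSemiring using (solve; _:=_; _:+_; _:*_)
      X = element x
      X′ = element x′
      Y = element y
      Y′ = element y′
      -- The slope `(y - y′) / (x - x′)` of the line through the two points, which lies in the
      -- subfield.
      found = element-complete (z * (Y - Y′)) (fixed-*
        (fixed-inverse zx≈1 (fixed-- (element-fixed x) (element-fixed x′)))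
        (fixed-- (element-fixed y) (element-fixed y′)))
      m = proj₁ found
      M = element m

      difference : M * (X - X′) ≈ Y - Y′
      difference = begin
        M * (X - X′)                ≈⟨ *-congʳ (proj₂ found) ⟩
        z * (Y - Y′) * (X - X′)
          ≈⟨ solve 3 (λ z u v → z :* u :* v := z :* v :* u) refl z (Y - Y′) (X - X′) ⟩
        z * (X - X′) * (Y - Y′)     ≈⟨ trans (*-congʳ zx≈1) (*-identityˡ _) ⟩
        Y - Y′                      ∎

      lemma : M * X - Y ≈ M * X′ - Y′
      lemma = begin
        M * X - Y
          ≈⟨ +-congʳ (*-congˡ (trans (sym (+-identityʳ X)) (+-congˡ (sym (-‿inverseˡ X′))))) ⟩
        M * (X + (- X′ + X′)) - Y
          ≈⟨ solve 5 (λ M X n X′ y → M :* (X :+ (n :+ X′)) :+ y := M :* (X :+ n) :+ (M :* X′ :+ y))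
              refl M X (- X′) X′ (- Y) ⟩
        M * (X - X′) + (M * X′ - Y)           ≈⟨ +-congʳ difference ⟩
        Y - Y′ + (M * X′ - Y)
          ≈⟨ solve 4 (λ Y n a y → Y :+ n :+ (a :+ y) := a :+ n :+ (y :+ Y))
              refl Y (- Y′) (M * X′) (- Y) ⟩
        M * X′ - Y′ + (- Y + Y)
          ≈⟨ trans (+-congˡ (-‿inverseˡ Y)) (+-identityʳ _) ⟩
        M * X′ - Y′                           ∎

  planar : PlanarOperation q
  planar = record { op = op ; reciprocal = reciprocal ; slope = slope }

planarOperation : ∀ {q} → PrimePower q → PlanarOperation q
planarOperation record { base = p ; exponent = suc k-1 ; prime = pr ; equation = ≡.refl }
  -- From here on `𝔽ₚ` is any finite ring whose homomorphic images are annihilated by `p`.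
  with ℤmod p (prime⇒2≤ pr) | ℤmod-characteristic (prime⇒2≤ pr)
... | 𝔽ₚ | characteristic
  with splittingRing 𝔽ₚ (frobeniusPolynomial (FiniteRing.commutativeRing 𝔽ₚ) (p ℕ.^ suc k-1))
... | A , g , g-isHom , splits with residueField A
... | Q , isField = FixedField.planar K (FiniteRing.1≉0 Q.ring) isField pr
        (characteristic K (composeHom F R K g-isHom Q.isHom)) k-1
        (Polynomial.Splits-cong K
          (λ i → CommutativeRing.trans K
            (IsRingHomomorphism.⟦⟧-cong Q.isHom (frobeniusPolynomial-hom F R g-isHom (p ℕ.^ suc k-1) i))
            (frobeniusPolynomial-hom R K Q.isHom (p ℕ.^ suc k-1) i))
          (Splits-hom R K Q.isHom splits))
  where
  module Q = FiniteQuotient Q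
  F = FiniteRing.commutativeRing 𝔽ₚ
  R = FiniteRing.commutativeRing A
  K = FiniteRing.commutativeRing Q.ring

-- Projective planes

open import Data.Empty using (⊥; ⊥-elim-irr)
open import Data.Fin.Base
  using (_↑ˡ_; _↑ʳ_; splitAt; join; combine; quotient; remainder)
open import Data.Fin.Properties
  using (pigeonhole; splitAt-join; splitAt-↑ˡ; splitAt-↑ʳ; join-splitAt; combine-remQuot;
         remQuot-combine; combine-injective; combine-injectiveˡ; combine-monoˡ-<;
         toℕ-injective; toℕ-combine; <-cmp)
open import Data.List.Base using (length; lookup; filter; mapMaybe; allFin; cartesianProduct)
open import Data.List.Extrema.Nat using (max≤v⁺)
open import Data.List.Membership.Propositional using (_∈_)
open import Data.List.Membership.Propositional.Properties using (∈-lookup; ∈-filter⁻)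
open import Data.List.Relation.Unary.Unique.Propositional using (Unique; []; _∷_)
open import Data.List.Relation.Unary.Unique.Propositional.Properties
  using (allFin⁺; cartesianProduct⁺; filter⁺)
open import Data.Maybe.Base using (Maybe; just; nothing)
open import Data.Nat.Base
  using (_+_; _*_; _^_; _≥_; s≤s⁻¹; NonZero; ∣_-_∣; _/_; _%_)
open import Data.Nat.DivMod using (_mod_; m%n<n; m<n⇒m%n≡m; m<n*o⇒m/o<n; m≡m%n+[m/n]*n)
open import Data.Nat.Tactic.RingSolver using (solve-∀)
import Data.Sum.Base as Sum
open import Function.Bundles using (Equivalence)
open import Relation.Binary.Definitions using (tri<; tri≈; tri>)
open import Relation.Binary.PropositionalEquality
  using (refl; sym; trans; cong; cong₂; subst; subst₂; module ≡-Reasoning)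
open import Relation.Nullary.Decidable using (¬?; _×-dec_; _⊎-dec_; recompute)

-- Incidence in a projective plane identified with its dual by a polarity.
record Polarity (s d : ℕ) : Set where
  field
    neighbour : Fin s → Fin d → Fin s

  Incident : Fin s → Fin s → Set
  Incident x y = ∃[ i ] neighbour x i ≡ y

  field
    symmetric : ∀ {x y} → Incident x y → Incident y x
    joined    : ∀ x y → ∃[ z ] (Incident z x × Incident z y)

-- The point (x , y) lies on the line with slope m and intercept -b when
-- m x - y = b; exchanging (x , y) with (m , b) is the polarity.
module _ {q : ℕ} (planar : PlanarOperation q) where
  open PlanarOperation planar

  private
    data Point : Set where
      affine   : Fin q → Fin q → Point
      slopeAt  : Fin q → Point
      infinity : Point

    -- Read as a line, `slopeAt m` is the vertical line with abscissa `m`, and `infinity` is the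
    -- line at infinity. On the other lines the index `zero` gives the point at infinity.
    neighbour : Point → Fin (suc q) → Point
    neighbour (affine x y) zero    = slopeAt x
    neighbour (affine x y) (suc m) = affine m (op m x y)
    neighbour (slopeAt m)  zero    = infinity
    neighbour (slopeAt m)  (suc b) = affine m b
    neighbour infinity     zero    = infinity
    neighbour infinity     (suc c) = slopeAt c

    symmetric : ∀ P i → ∃[ j ] neighbour (neighbour P i) j ≡ P
    symmetric (affine x y) zero    = suc y , refl
    symmetric (affine x y) (suc m) = suc x , cong (affine x) (reciprocal refl)
    symmetric (slopeAt m)  zero    = suc m , refl
    symmetric (slopeAt m)  (suc b) = zero , refl
    symmetric infinity     zero    = zero , refl
    symmetric infinity     (suc c) = zero , refl

    Joined : Point → Point → Set
    Joined P Q = ∃[ R ] ((∃[ i ] neighbour R i ≡ P) × (∃[ i ] neighbour R i ≡ Q))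

    Joined-sym : ∀ {P Q} → Joined P Q → Joined Q P
    Joined-sym (R , RP , RQ) = R , RQ , RP

    joined : ∀ P Q → Joined P Q
    joined (affine x y) (affine x′ y′) with x Fin.≟ x′
    -- Equal abscissae lie on a vertical line; otherwise `slope` supplies the line.
    ... | yes refl = slopeAt x , (suc y , refl) , (suc y′ , refl)
    ... | no x≢x′  with slope y y′ x≢x′
    ...   | m , eq = affine m (op m x y) ,
                     (suc x , cong (affine x) (reciprocal refl)) ,
                     (suc x′ , cong (affine x′) (reciprocal (sym eq)))
    -- The line of slope `m` through `(x , y)`.
    joined (affine x y) (slopeAt m) = affine m (op m x y) ,
                                      (suc x , cong (affine x) (reciprocal refl)) ,
                                      (zero , refl)
    joined (affine x y) infinity     = slopeAt x , (suc y , refl) , (zero , refl)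
    joined (slopeAt m)  (slopeAt m′) = infinity , (suc m , refl) , (suc m′ , refl)
    joined (slopeAt m)  infinity     = infinity , (suc m , refl) , (zero , refl)
    joined infinity     infinity     = infinity , (zero , refl) , (zero , refl)
    joined (slopeAt m)  (affine x y) = Joined-sym (joined (affine x y) (slopeAt m))
    joined infinity     (affine x y) = Joined-sym (joined (affine x y) infinity)
    joined infinity     (slopeAt m)  = Joined-sym (joined (slopeAt m) infinity)

    encode : Point → Fin (suc (q + q * q))
    encode (affine x y) = suc (q ↑ʳ combine x y)
    encode (slopeAt m)  = suc (m ↑ˡ (q * q))
    encode infinity     = zero

    decodeFinite : Fin q ⊎ Fin (q * q) → Point
    decodeFinite (inj₁ m) = slopeAt m
    decodeFinite (inj₂ j) = affine (quotient q j) (remainder {q} q j)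

    decode : Fin (suc (q + q * q)) → Point
    decode zero    = infinity
    decode (suc i) = decodeFinite (splitAt q i)

    decode-encode : ∀ P → decode (encode P) ≡ P
    decode-encode (affine x y) rewrite splitAt-↑ʳ q (q * q) (combine x y) =
      cong (λ (a , b) → affine a b) (remQuot-combine {q} x y)
    decode-encode (slopeAt m)  rewrite splitAt-↑ˡ q m (q * q) = refl
    decode-encode infinity     = refl

    encode-decode : ∀ i → encode (decode i) ≡ i
    encode-decode zero    = refl
    encode-decode (suc i) = trans (finite (splitAt q i)) (cong suc (join-splitAt q (q * q) i))
      where
      finite : ∀ s → encode (decodeFinite s) ≡ suc (join q (q * q) s)
      finite (inj₁ m) = refl
      finite (inj₂ j) = cong (λ k → suc (q ↑ʳ k)) (combine-remQuot {q} q j)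

  polarity : Polarity (suc (q + q * q)) (suc q)
  polarity = record
    { neighbour = λ x i → encode (neighbour (decode x) i)
    ; symmetric = λ { {x} (i , refl) →
        let (j , eq) = symmetric (decode x) i in
        j , trans (cong (λ P → encode (neighbour P j)) (decode-encode _))
                  (trans (cong encode eq) (encode-decode x)) }
    ; joined = λ x y →
        let (R , (i , eq) , (j , eq′)) = joined (decode x) (decode y)
            through : ∀ k z → neighbour R k ≡ decode z → encode (neighbour (decode (encode R)) k) ≡ z
            through k z e = trans (cong (λ P → encode (neighbour P k)) (decode-encode R))
                                  (trans (cong encode e) (encode-decode z))
        in encode R , (i , through i x eq) , (j , through j y eq′)
    }

-- Counting in lists without repetition

lookup-≢ : ∀ {A : Set} {xs : List A} → Unique xs →
           ∀ {i j} → i Fin.< j → lookup xs i ≢ lookup xs j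
lookup-≢ (x∉xs ∷ _)  {zero}  {suc j} _   = All.lookup x∉xs (∈-lookup j)
lookup-≢ (_ ∷ xs!)   {suc i} {suc j} i<j = lookup-≢ xs! (s≤s⁻¹ i<j)

-- In a longer list two positions would share a label, by the pigeonhole principle. Labels form a
-- relation, so that they need to exist only for members of the list.
length≤ : ∀ {A : Set} {k} {xs : List A} → Unique xs → (R : A → Fin k → Set) →
          (∀ {x} → x ∈ xs → ∃[ i ] R x i) → (∀ {x y i} → R x i → R y i → x ≡ y) → length xs ≤ k
length≤ {k = k} {xs} xs! R total injective with length xs ℕ.≤? k
... | yes ≤k = ≤k
... | no  ≰k with pigeonhole (ℕ.≰⇒> ≰k) (λ i → proj₁ (total (∈-lookup {xs = xs} i)))
...   | i , j , i<j , eq = contradiction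
        (injective (proj₂ (total (∈-lookup i)))
           (subst (R _) (sym eq) (proj₂ (total (∈-lookup j)))))
        (lookup-≢ xs! i<j)

length-filter≤ : ∀ {A : Set} {k} {xs : List A} {P : A → Set} (P? : ∀ x → Dec (P x)) → Unique xs →
                 (R : A → Fin k → Set) → (∀ {x} → P x → ∃[ i ] R x i) →
                 (∀ {x y i} → P x → P y → R x i → R y i → x ≡ y) → length (filter P? xs) ≤ k
length-filter≤ {xs = xs} {P} P? xs! R total injective =
  length≤ (filter⁺ P? xs!) (λ x i → P x × R x i)
  (λ x∈ → let px = proj₂ (∈-filter⁻ P? {xs = xs} x∈) ; (i , r) = total px in i , px , r)
  (λ (px , rx) (py , ry) → injective px py rx ry)

mapMaybe-unique : ∀ {A B : Set} {g : A → Maybe B} →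
                  (∀ {x y z} → g x ≡ just z → g y ≡ just z → x ≡ y) →
                  ∀ {xs} → Unique xs → Unique (mapMaybe g xs)
mapMaybe-unique {g = g} injective [] = []
mapMaybe-unique {A} {B} {g} injective {x ∷ xs} (x∉xs ∷ xs!) with g x in gx≡z
... | nothing = mapMaybe-unique injective xs!
... | just z  = fresh x∉xs ∷ mapMaybe-unique injective xs!
  where
  fresh : ∀ {ys} → All (x ≢_) ys → All (z ≢_) (mapMaybe g ys)
  fresh []                       = []
  fresh {y ∷ ys} (x≢y ∷ x∉ys) with g y in gy≡w
  ... | nothing = fresh x∉ys
  ... | just w  = (λ { refl → x≢y (injective gx≡z gy≡w) }) ∷ fresh x∉ys

-- toEdge is solved by unification to the local function in the definition of edges.
mutual
  toEdge : ∀ {N} (G : Graph N) → Fin N × Fin N → Maybe (Edge G)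
  toEdge = _

  edges≡ : ∀ {N} (G : Graph N) →
           edges G ≡ mapMaybe (toEdge G) (cartesianProduct (allFin N) (allFin N))
  edges≡ G = refl

toEdge-ends : ∀ {N} (G : Graph N) {x e} → toEdge G x ≡ just e → (src e , tgt e) ≡ x
toEdge-ends G {u , v} eq with u Fin.<? v | adj? G u v
toEdge-ends G {u , v} refl | yes u<v | yes uv = refl

edges-unique : ∀ {N} (G : Graph N) → Unique (edges G)
edges-unique {N} G = subst Unique (sym (edges≡ G)) (mapMaybe-unique
  (λ eq eq′ → trans (sym (toEdge-ends G eq)) (toEdge-ends G eq′))
  (cartesianProduct⁺ (allFin⁺ N) (allFin⁺ N)))

-- The colouring of the host and the guest graph

-- The ceiling is the negative of the floor of `- n / d`, so the bound is the negated inequality for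
-- the floor; the absolute value can only enlarge it.
n≤⌈n/d⌉*d : ∀ n d .{{_ : NonZero d}} → n ≤ ⌈ n / d ⌉ * d
n≤⌈n/d⌉*d n d@(suc _) = ℤ.drop‿+≤+ (begin
  ℤ.+ n                                ≡⟨ ℤ.neg-involutive (ℤ.+ n) ⟨
  ℤ.- (ℤ.- ℤ.+ n)                      ≤⟨ ℤ.neg-mono-≤ (ℤ.[n/d]*d≤n (ℤ.- ℤ.+ n) (ℤ.+ d)) ⟩
  ℤ.- (f ℤ.* ℤ.+ d)                    ≡⟨ ℤ.neg-distribˡ-* f (ℤ.+ d) ⟩
  (ℤ.- f) ℤ.* ℤ.+ d                    ≤⟨ ℤ.*-monoʳ-≤-nonNeg (ℤ.+ d) (i≤∣i∣ (ℤ.- f)) ⟩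
  ℤ.+ ℤ.∣ ℤ.- f ∣ ℤ.* ℤ.+ d            ≡⟨ ℤ.pos-* ℤ.∣ ℤ.- f ∣ d ⟨
  ℤ.+ (⌈ n / d ⌉ * d)                  ∎)
  where
  open ℤ.≤-Reasoning
  f = (ℤ.- ℤ.+ n) ℤ./ ℤ.+ d
  i≤∣i∣ : ∀ i → i ℤ.≤ ℤ.+ ℤ.∣ i ∣
  i≤∣i∣ (ℤ.+ _)    = ℤ.≤-refl
  i≤∣i∣ ℤ.-[1+ _ ] = ℤ.-≤+

quotient-combine : ∀ {m n} (i : Fin m) (j : Fin n) → quotient n (combine i j) ≡ i
quotient-combine i j = cong proj₁ (remQuot-combine i j)

remainder-combine : ∀ {m n} (i : Fin m) (j : Fin n) → remainder {m} n (combine i j) ≡ j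
remainder-combine {m} i j = cong proj₂ (remQuot-combine i j)

remQuot-injective : ∀ {m n} {u v : Fin (m * n)} → quotient {m} n u ≡ quotient n v →
                    remainder {m} n u ≡ remainder {m} n v → u ≡ v
remQuot-injective {m} {n} {u} {v} eq eq′ =
  trans (sym (combine-remQuot {m} n u)) (trans (cong₂ combine eq eq′) (combine-remQuot {m} n v))

-- Every colour class is a star whose centre lies in a lower class than its leaves.
module StarColoring (m n k D : ℕ) .{{_ : NonZero k}} (n≤D*k : n ≤ D * k) where

  -- Blocks of `k` consecutive positions; by `n ≤ D * k` there are at most `D` of them.
  part : Fin n → Fin D
  part r = fromℕ< (m<n*o⇒m/o<n {toℕ r} {D} {k} (ℕ.<-≤-trans (toℕ<n r) n≤D*k))

  leafColor : Fin (m * n) → Fin (m * D)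
  leafColor v = combine (quotient {m} n v) (part (remainder {m} n v))

  coloring : Coloring K[ m ⊗ n ]
  coloring e = toℕ (combine (src e) (leafColor (tgt e)))

  private
    -- A colour fixes the source together with the class and block of the target, so edges of one
    -- colour are told apart by this number below `k`.
    position : Edge K[ m ⊗ n ] → ℕ
    position e = toℕ (remainder {m} n (tgt e)) % k

    part-injective : ∀ {r r′} → part r ≡ part r′ → toℕ r % k ≡ toℕ r′ % k → r ≡ r′
    part-injective {r} {r′} eq eq′ = toℕ-injective (begin
      toℕ r                             ≡⟨ m≡m%n+[m/n]*n (toℕ r) k ⟩
      toℕ r % k + (toℕ r / k) * k       ≡⟨ cong₂ (λ a b → a + b * k) eq′ quotients ⟩
      toℕ r′ % k + (toℕ r′ / k) * k     ≡⟨ m≡m%n+[m/n]*n (toℕ r′) k ⟨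
      toℕ r′                            ∎)
      where
      open ≡-Reasoning
      quotients : toℕ r / k ≡ toℕ r′ / k
      quotients = trans (sym (toℕ-fromℕ< _)) (trans (cong toℕ eq) (toℕ-fromℕ< _))

    edge-≡ : ∀ {e e′ : Edge K[ m ⊗ n ]} → src e ≡ src e′ → tgt e ≡ tgt e′ → e ≡ e′
    edge-≡ refl refl = refl

    color-position-injective : ∀ {e e′} → coloring e ≡ coloring e′ →
                               position e ≡ position e′ → e ≡ e′
    color-position-injective {e} {e′} eq eq′ =
      let (src≡ , leaf≡)   = combine-injective (src e) (leafColor (tgt e))
                               (src e′) (leafColor (tgt e′)) (toℕ-injective eq)
          (class≡ , part≡) = combine-injective (quotient {m} n (tgt e)) _
                               (quotient {m} n (tgt e′)) _ leaf≡
      in edge-≡ {e} {e′} src≡ (remQuot-injective {m} class≡ (part-injective part≡ eq′))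

  bounded : GloballyBounded k coloring
  bounded i = length-filter≤ _ (edges-unique K[ m ⊗ n ])
    (λ e j → position e ≡ toℕ j)
    (λ {e} _ → fromℕ< (m%n<n _ k) , sym (toℕ-fromℕ< (m%n<n _ k)))
    (λ {e} {e′} ce≡i ce′≡i p p′ →
      color-position-injective {e} {e′} (trans ce≡i (sym ce′≡i)) (trans p (sym p′)))

  -- Vertices are numbered class by class, so the endpoint in the lower class is the source.
  joins-ordered : ∀ {e : Edge K[ m ⊗ n ]} {u v} → Joins e u v →
                  quotient {m} n u Fin.< quotient {m} n v → src e ≡ u × tgt e ≡ v
  joins-ordered (inj₁ ends) _ = ends
  joins-ordered {edge v u v<u _} (inj₂ (refl , refl)) u≺v =
    contradiction (recompute (v Fin.<? u) v<u) (ℕ.<-asym u<v)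
    where
    u<v : u Fin.< v
    u<v = subst₂ Fin._<_ (combine-remQuot {m} n u) (combine-remQuot {m} n v)
      (combine-monoˡ-< {m} {n} (remainder {m} n u) (remainder {m} n v) u≺v)

  joins-classes : ∀ {e : Edge K[ m ⊗ n ]} {u v} → Joins e u v → quotient {m} n u ≢ quotient {m} n v
  joins-classes {edge _ _ _ u≁v} (inj₁ (refl , refl)) eq = ⊥-elim-irr (u≁v eq)
  joins-classes {edge _ _ _ v≁u} (inj₂ (refl , refl)) eq = ⊥-elim-irr (v≁u (sym eq))

-- Proper colourings of powers of paths

module _ {m N : ℕ} (ψ : ℕ → Fin m)
  (proper : ∀ {x y} → x < y → y < N → y < x + m → ψ x ≢ ψ y) where

  -- The m - 1 colours strictly between x and x + m leave only one for both ends.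
  power-of-path-periodic : ∀ x → x + m < N → ψ x ≡ ψ (x + m)
  power-of-path-periodic x x+m<N with pigeonhole (ℕ.n<1+n m) (λ j → ψ (x + toℕ j))
  ... | i , j , i<j , eq with toℕ j ℕ.<? toℕ i + m
  ...   | yes j<i+m = contradiction eq (proper
            (ℕ.+-monoʳ-< x i<j)
            (ℕ.≤-<-trans (ℕ.+-monoʳ-≤ x (s≤s⁻¹ (toℕ<n j))) x+m<N)
            (subst (x + toℕ j <_) (sym (ℕ.+-assoc x (toℕ i) m)) (ℕ.+-monoʳ-< x j<i+m)))
  -- Two indices that are at most `m` and at least `m` apart are 0 and `m`.
  ...   | no j≮i+m = subst₂ (λ a b → ψ a ≡ ψ b)
            (trans (cong (x +_) i≡0) (ℕ.+-identityʳ x)) (cong (x +_) j≡m) eq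
    where
    i+m≤j : toℕ i + m ≤ toℕ j
    i+m≤j = ℕ.≮⇒≥ j≮i+m
    j≤m : toℕ j ≤ m
    j≤m = s≤s⁻¹ (toℕ<n j)
    i≡0 : toℕ i ≡ 0
    i≡0 = ℕ.n≤0⇒n≡0 (ℕ.+-cancelʳ-≤ m (toℕ i) 0 (ℕ.≤-trans i+m≤j j≤m))
    j≡m : toℕ j ≡ m
    j≡m = ℕ.≤-antisym j≤m (ℕ.≤-trans (ℕ.m≤n+m m (toℕ i)) i+m≤j)

  -- By iterating the period, a proper colouring is determined by its first `m` values.
  power-of-path-constant : ∀ t r → m * t + r < N → ψ (m * t + r) ≡ ψ r
  power-of-path-constant zero    r _  rewrite ℕ.*-zeroʳ m = refl
  power-of-path-constant (suc t) r lt = trans (cong ψ shift) (trans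
    (sym (power-of-path-periodic (m * t + r) (subst (_< N) shift lt)))
    (power-of-path-constant t r (ℕ.≤-<-trans (ℕ.m≤m+n (m * t + r) m) (subst (_< N) shift lt))))
    where
    shift : m * suc t + r ≡ m * t + r + m
    shift = rearrange m t r
      where
      rearrange : ∀ m t r → m * suc t + r ≡ m * t + r + m
      rearrange = solve-∀

-- The guest graph

-- Vertex combine t r of the guest is the (m t + r)-th vertex of a path whose
-- (m - 1)-st power makes the colour classes of any proper m-colouring the residue
-- classes r; on top of it, the residues 0 and 1 carry the incidence graph.
module Guest (m-2 s d : ℕ) (polarity : Polarity s d) where
  open Polarity polarity

  m : ℕ
  m = suc (suc m-2)

  index : Fin (s * m) → Fin s
  index = quotient {s} m

  residue : Fin (s * m) → Fin m
  residue = remainder {s} m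

  Mates : Fin m → Fin m → Set
  Mates a b = (a ≡ zero × b ≡ suc zero) ⊎ (a ≡ suc zero × b ≡ zero)

  Near Cross : Fin (s * m) → Fin (s * m) → Set
  Near u v  = toℕ u ≢ toℕ v × ∣ toℕ u - toℕ v ∣ < m
  Cross u v = Mates (residue u) (residue v) × Incident (index u) (index v)

  near? : ∀ u v → Dec (Near u v)
  near? u v = ¬? (toℕ u ℕ.≟ toℕ v) ×-dec (∣ toℕ u - toℕ v ∣ ℕ.<? m)

  cross? : ∀ u v → Dec (Cross u v)
  cross? u v =
    ((residue u Fin.≟ zero ×-dec residue v Fin.≟ suc zero) ⊎-dec
     (residue u Fin.≟ suc zero ×-dec residue v Fin.≟ zero))
    ×-dec any? (λ i → neighbour (index u) i Fin.≟ index v)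

  Mates-sym : ∀ {a b} → Mates a b → Mates b a
  Mates-sym (inj₁ (a≡0 , b≡1)) = inj₂ (b≡1 , a≡0)
  Mates-sym (inj₂ (a≡1 , b≡0)) = inj₁ (b≡0 , a≡1)

  Mates-irrefl : ∀ {a} → ¬ Mates a a
  Mates-irrefl (inj₁ (refl , ()))
  Mates-irrefl (inj₂ (refl , ()))

  Mates-functional : ∀ {a b c} → Mates a b → Mates a c → b ≡ c
  Mates-functional (inj₁ (_ , refl))    (inj₁ (_ , refl)) = refl
  Mates-functional (inj₂ (_ , refl))    (inj₂ (_ , refl)) = refl
  Mates-functional (inj₁ (refl , refl)) (inj₂ (() , _))
  Mates-functional (inj₂ (refl , refl)) (inj₁ (() , _))

  toℕ-index-residue : ∀ v → toℕ v ≡ m * toℕ (index v) + toℕ (residue v)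
  toℕ-index-residue v =
    trans (cong toℕ (sym (combine-remQuot {s} m v))) (toℕ-combine (index v) (residue v))

  -- Numbers with equal residues differ by a multiple of `m`, so a distance below `m` makes them
  -- equal.
  near-residue : ∀ {u v} → residue u ≡ residue v → ¬ Near u v
  near-residue {u} {v} r≡ (u≢v , close) = u≢v (cong toℕ (remQuot-injective {s} index≡ r≡))
    where
    open ≡-Reasoning
    a = toℕ (index u)
    b = toℕ (index v)
    r = toℕ (residue v)
    distance : ∣ toℕ u - toℕ v ∣ ≡ m * ∣ a - b ∣
    distance = begin
      ∣ toℕ u - toℕ v ∣
        ≡⟨ cong₂ ∣_-_∣ (trans (toℕ-index-residue u) (cong (λ r → m * a + toℕ r) r≡))
                       (toℕ-index-residue v) ⟩
      ∣ m * a + r - m * b + r ∣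
        ≡⟨ cong₂ ∣_-_∣ (ℕ.+-comm (m * a) r) (ℕ.+-comm (m * b) r) ⟩
      ∣ r + m * a - r + m * b ∣        ≡⟨ ℕ.∣m+n-m+o∣≡∣n-o∣ r (m * a) (m * b) ⟩
      ∣ m * a - m * b ∣                ≡⟨ ℕ.*-distribˡ-∣-∣ m a b ⟨
      m * ∣ a - b ∣                    ∎
    index≡ : index u ≡ index v
    index≡ = toℕ-injective (ℕ.∣m-n∣≡0⇒m≡n (ℕ.n<1⇒n≡0 (ℕ.*-cancelˡ-< m ∣ a - b ∣ 1
      (subst₂ _<_ distance (sym (ℕ.*-identityʳ m)) close))))

  guest : Graph (s * m)
  guest = record
    { Adj    = λ u v → Near u v ⊎ Cross u v
    ; adj?   = λ u v → near? u v ⊎-dec cross? u v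
    ; symm   = λ {u} {v} → Sum.map
        (λ (u≢v , close) → u≢v ∘ sym , subst (_< m) (ℕ.∣-∣-comm (toℕ u) (toℕ v)) close)
        (λ (mates , incident) → Mates-sym mates , symmetric incident)
    ; irrefl = λ v → [ (λ (v≢v , _) → v≢v refl) , (λ (mates , _) → Mates-irrefl mates) ]′
    }

  partition : Partition m guest
  partition = record
    { class = residue
    ; independent = λ {u} {v} r≡ →
        [ near-residue r≡ , (λ (mates , _) → Mates-irrefl (subst (Mates (residue u)) (sym r≡) mates)) ]′
    }

  classSize≤s : ∀ i → classSize partition i ≤ s
  classSize≤s i = length-filter≤ _ (allFin⁺ (s * m))
    (λ v t → index v ≡ t)
    (λ _ → _ , refl)
    (λ ru rv tu tv → remQuot-injective {s} (trans tu (sym tv)) (trans ru (sym rv)))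

  private
    -- A near neighbour is labelled by its offset from `v`, shifted by `m - 1` so that the `2m - 1`
    -- offsets from `-(m - 1)` to `m - 1` start at 0; a cross neighbour is labelled by its place
    -- among the `d` neighbours in the polarity.
    NeighbourAt : Fin (s * m) → Fin (s * m) → Fin (m + suc m-2) ⊎ Fin d → Set
    NeighbourAt v w (inj₁ i) = toℕ w + m ≡ suc (toℕ v + toℕ i)
    NeighbourAt v w (inj₂ i) = Mates (residue v) (residue w) × neighbour (index v) i ≡ index w

    neighbourAt : ∀ {v w} → Adj guest v w → ∃[ i ] NeighbourAt v w i
    neighbourAt {v} {w} (inj₁ (_ , close)) = inj₁ (fromℕ< i<) , (begin-equality
      toℕ w + m                         ≡⟨ ℕ.m+[n∸m]≡n v<w+m ⟨
      suc (toℕ v) + i                   ≡⟨ cong (λ j → suc (toℕ v + j)) (toℕ-fromℕ< i<) ⟨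
      suc (toℕ v + toℕ (fromℕ< i<))     ∎)
      where
      open ℕ.≤-Reasoning
      i = toℕ w + m ∸ suc (toℕ v)
      v<w+m : toℕ v < toℕ w + m
      v<w+m = ℕ.≤-<-trans (ℕ.m≤n+∣m-n∣ (toℕ v) (toℕ w)) (ℕ.+-monoʳ-< (toℕ w) close)
      w<v+m : toℕ w < toℕ v + m
      w<v+m = ℕ.≤-<-trans (ℕ.m≤n+∣n-m∣ (toℕ w) (toℕ v)) (ℕ.+-monoʳ-< (toℕ v) close)
      i< : i < m + suc m-2
      i< = ℕ.+-cancelˡ-< (suc (toℕ v)) i (m + suc m-2) (begin-strict
        suc (toℕ v) + i                    ≡⟨ ℕ.m+[n∸m]≡n v<w+m ⟩
        toℕ w + m                          <⟨ ℕ.+-monoˡ-< m w<v+m ⟩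
        toℕ v + m + m                      ≡⟨ rearrange (toℕ v) m-2 ⟩
        suc (toℕ v) + (m + suc m-2)        ∎)
        where
        rearrange : ∀ v m-2 → v + suc (suc m-2) + suc (suc m-2)
                            ≡ suc v + (suc (suc m-2) + suc m-2)
        rearrange = solve-∀
    neighbourAt (inj₂ (mates , (i , eq))) = inj₂ i , mates , eq

    neighbourAt-injective : ∀ {v w w′} i → NeighbourAt v w i → NeighbourAt v w′ i → w ≡ w′
    neighbourAt-injective (inj₁ i) eq eq′ = toℕ-injective (ℕ.+-cancelʳ-≡ m _ _ (trans eq (sym eq′)))
    neighbourAt-injective (inj₂ i) (mates , eq) (mates′ , eq′) =
      remQuot-injective {s} (trans (sym eq) eq′) (Mates-functional mates mates′)

  degree≤ : ∀ v → degree guest v ≤ m + suc m-2 + d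
  degree≤ v = length-filter≤ _ (allFin⁺ (s * m))
    (λ w i → NeighbourAt v w (splitAt (m + suc m-2) i))
    (λ {w} vw → let (i , at) = neighbourAt vw in
      join (m + suc m-2) d i , subst (NeighbourAt v w) (sym (splitAt-join (m + suc m-2) d i)) at)
    (λ {_} {_} {i} _ _ → neighbourAt-injective (splitAt (m + suc m-2) i))

  maxDegree≤ : maxDegree guest ≤ m + suc m-2 + d
  maxDegree≤ = max≤v⁺ z≤n (All.map⁺ (All.universal degree≤ (allFin (s * m))))

  -- Absence of properly coloured copies

  module Uncontained (n k D : ℕ) .{{_ : NonZero k}} (n≤D*k : n ≤ D * k) (D<s : D < s) where
    open StarColoring m n k D n≤D*k

    module _ (S : Subgraph K[ m ⊗ n ]) (copy : IsCopyOf guest S)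
             (proper : ProperlyColored coloring S) where
      open Subgraph S
      open IsCopyOf copy

      private
        host : Fin (s * m) → Fin m
        host v = quotient {m} n (f v)

        host-proper : ∀ {u v} → Adj guest u v → host u ≢ host v
        host-proper {u} {v} uv =
          let (e , _ , joins) = Equivalence.to (preserving u v) uv in joins-classes {e} joins

        instance
          s≢0 : NonZero s
          s≢0 = ℕ.>-nonZero (ℕ.≤-<-trans z≤n D<s)
          s*m≢0 : NonZero (s * m)
          s*m≢0 = ℕ.m*n≢0 s m

        -- Reduction modulo `s * m` makes the function total; for `x` below `s * m` it gives the
        -- vertex numbered `x`.
        vertex : ℕ → Fin (s * m)
        vertex x = x mod (s * m)

        toℕ-vertex : ∀ {x} → x < s * m → toℕ (vertex x) ≡ x
        toℕ-vertex {x} x< = trans (toℕ-fromℕ< (m%n<n x (s * m))) (m<n⇒m%n≡m x<)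

        vertex-proper : ∀ {x y} → x < y → y < s * m → y < x + m →
                        host (vertex x) ≢ host (vertex y)
        vertex-proper {x} {y} x<y y<N y<x+m = host-proper (inj₁
          ( (λ eq → ℕ.<⇒≢ x<y (trans (sym x≡) (trans eq y≡)))
          , subst₂ (λ a b → ∣ a - b ∣ < m) (sym x≡) (sym y≡)
              (subst (_< m) (sym (ℕ.m≤n⇒∣m-n∣≡n∸m (ℕ.<⇒≤ x<y))) (ℕ.m<n+o⇒m∸n<o y x y<x+m))))
          where
          x≡ = toℕ-vertex (ℕ.<-trans x<y y<N)
          y≡ = toℕ-vertex y<N

        -- Guest edges go to host edges, so the host classes properly colour the power of the path
        -- with `m` colours; hence each residue class lands in a single host class.
        host-residue : ∀ (t : Fin s) (r : Fin m) → host (combine t r) ≡ host (vertex (toℕ r))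
        host-residue t r = trans
          (cong host (toℕ-injective (trans toℕ≡ (sym (toℕ-vertex lt)))))
          (power-of-path-constant (host ∘ vertex) vertex-proper (toℕ t) (toℕ r) lt)
          where
          toℕ≡ = toℕ-combine t r
          lt : m * toℕ t + toℕ r < s * m
          lt = subst (_< s * m) toℕ≡ (toℕ<n (combine t r))

        -- The `s` vertices of residue `r′` all land in the higher class, which has only `D` parts,
        -- so two of them share a part. A common neighbour of residue `r` is the source of the edges
        -- to both, and these two edges get the same colour.
        clash : ∀ {r r′} → Mates r r′ → ¬ host (vertex (toℕ r)) Fin.< host (vertex (toℕ r′))
        clash {r} {r′} mates lower
          with pigeonhole D<s (λ t → part (remainder {m} n (f (combine t r′))))
        ... | t , t′ , t<t′ , part≡ with joined t t′
        ...   | ℓ , ℓt , ℓt′ =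
          contradiction colors≡ (proper Ee Ee′ e≢e′ (u , inj₁ src≡ , inj₁ src≡′))
          where
          u = f (combine ℓ r)

          edge-to : ∀ t → Incident ℓ t → ∃[ e ] (E e × src e ≡ u × tgt e ≡ f (combine t r′))
          edge-to t ℓt =
            let (e , Ee , joins) = Equivalence.to (preserving (combine ℓ r) (combine t r′)) (inj₂
                  ( subst₂ Mates (sym (remainder-combine ℓ r)) (sym (remainder-combine t r′)) mates
                  , subst₂ Incident (sym (quotient-combine ℓ r)) (sym (quotient-combine t r′)) ℓt))
            in e , Ee , joins-ordered {e} joins
                 -- The image of `ℓ` lies in the lower class, so the edge starts there.
                 (subst₂ Fin._<_ (sym (host-residue ℓ r)) (sym (host-residue t r′)) lower)

          e     = proj₁ (edge-to t ℓt)
          Ee    = proj₁ (proj₂ (edge-to t ℓt))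
          src≡  = proj₁ (proj₂ (proj₂ (edge-to t ℓt)))
          tgt≡  = proj₂ (proj₂ (proj₂ (edge-to t ℓt)))
          e′    = proj₁ (edge-to t′ ℓt′)
          Ee′   = proj₁ (proj₂ (edge-to t′ ℓt′))
          src≡′ = proj₁ (proj₂ (proj₂ (edge-to t′ ℓt′)))
          tgt≡′ = proj₂ (proj₂ (proj₂ (edge-to t′ ℓt′)))

          e≢e′ : e ≢ e′
          e≢e′ e≡e′ = ℕ.<⇒≢ t<t′ (cong toℕ (combine-injectiveˡ t r′ t′ r′
            (injective (trans (sym tgt≡) (trans (cong tgt e≡e′) tgt≡′)))))

          colors≡ : coloring e ≡ coloring e′
          colors≡ = cong₂ (λ a b → toℕ (combine a b)) (trans src≡ (sym src≡′))
            (trans (cong leafColor tgt≡) (trans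
              (cong₂ combine (trans (host-residue t r′) (sym (host-residue t′ r′))) part≡)
              (sym (cong leafColor tgt≡′))))

      -- Vertices 0 and 1 are adjacent on the path, so their classes differ; either order is refuted
      -- because `Mates` is symmetric.
      impossible : ⊥
      impossible with <-cmp (host (vertex 0)) (host (vertex 1))
      ... | tri< 0<1 _ _ = clash (inj₁ (refl , refl)) 0<1
      ... | tri> _ _ 1<0 = clash (inj₂ (refl , refl)) 1<0
      ... | tri≈ _ 0≡1 _ = vertex-proper ℕ.z<s
              (ℕ.≤-trans (s≤s (s≤s z≤n)) (ℕ.m≤n*m m s)) (s≤s (s≤s z≤n)) 0≡1

    uncontained : ¬ ContainsProperlyColored K[ m ⊗ n ] coloring guest
    uncontained (S , copy , proper) = impossible S copy proper

-- Choice of the parameters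

proposition1p6 : (m q n : ℕ) → m ≥ 2 → (pp : PrimePower q) → n ≥ 3 * q ^ 2 →
    Σ[ N ∈ ℕ ] Σ[ G ∈ Graph N ]
    ((Σ[ P ∈ Partition m G ] (∀ i → classSize P i ≤ 3 * q ^ 2))
    × maxDegree G ≤ q + 2 * m
    × (Σ[ c ∈ Coloring K[ m ⊗ n ] ]
    (GloballyBounded (⌈_/_⌉ n (q ^ 2 + q) {{q²+q-nonZero pp}}) c
    × ¬ ContainsProperlyColored K[ m ⊗ n ] c G)))
proposition1p6 (suc (suc m-2)) q n (s≤s (s≤s z≤n)) pp n≥3q² =
  s * m , guest , (partition , λ i → ℕ.≤-trans (classSize≤s i) s≤3q²)
  , ℕ.≤-trans maxDegree≤ (ℕ.≤-reflexive (degreeBound m-2 q))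
  , StarColoring.coloring m n k D n≤D*k
  , StarColoring.bounded m n k D n≤D*k
  , Uncontained.uncontained n k D n≤D*k D<s
  where
  -- `s` is the number of points of the plane, one more than the number `D` of parts: the surplus
  -- for the pigeonhole step.
  s = suc (q + q * q)
  D = q ^ 2 + q
  open Guest m-2 s (suc q) (polarity (planarOperation pp))
  instance
    q≢0 : NonZero q
    q≢0 = primePower⇒nonZero pp
    D≢0 : NonZero D
    D≢0 = q²+q-nonZero pp
  k = ⌈ n / D ⌉

  -- `2m - 1` offsets along the path and `q + 1` neighbours in the plane.
  degreeBound : ∀ m-2 q → suc (suc m-2) + suc m-2 + suc q ≡ q + 2 * suc (suc m-2)
  degreeBound = solve-∀

  q²≡q*q : q ^ 2 ≡ q * q
  q²≡q*q = cong (q *_) (ℕ.*-identityʳ q)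

  1≤q : 1 ≤ q
  1≤q = ℕ.>-nonZero⁻¹ q

  q≤q*q : q ≤ q * q
  q≤q*q = ℕ.m≤n*m q q

  s≤3q² : s ≤ 3 * q ^ 2
  s≤3q² = subst (λ x → s ≤ 3 * x) (sym q²≡q*q) (ℕ.+-mono-≤ (ℕ.≤-trans 1≤q q≤q*q)
    (ℕ.+-mono-≤ q≤q*q (ℕ.m≤m+n (q * q) 0)))

  D<s : D < s
  D<s = s≤s (ℕ.≤-reflexive (trans (ℕ.+-comm (q ^ 2) q) (cong (q +_) q²≡q*q)))

  n≤D*k : n ≤ D * k
  n≤D*k = subst (n ≤_) (ℕ.*-comm k D) (n≤⌈n/d⌉*d n D)

  instance
    k≢0 : NonZero k
    -- A vanishing `k` would force `n ≤ 0`, whereas `n ≥ 3 * q ^ 2 ≥ s > 0`.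
    k≢0 = ℕ.≢-nonZero λ k≡0 → ℕ.<⇒≱ (ℕ.≤-trans (ℕ.≤-trans (s≤s z≤n) s≤3q²) n≥3q²)
      (subst (n ≤_) (trans (cong (D *_) k≡0) (ℕ.*-zeroʳ D)) n≤D*k)
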